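{- A biased graph $\Omega$ is $\Gamma$-gainable for all groups $\Gamma$ of size at least three if and only if $\Omega$ is $\mathbb{Z}_3$-gainable and $\mathbb{Z}_2^2$-gainable.
   Context: Graphs are finite and may have loops and parallel edges. A cycle of a graph is a nonempty connected subgraph in which every vertex has degree $2$ (so a loop is a 1-edge cycle and two parallel edges form a 2-edge cycle). A theta subgraph consists of two distinct vertices and three internally disjoint paths joining them. A biased graph is a pair $\Omega=(G,\mathcal{B})$ where $G$ is a graph and $\mathcal{B}$ is a set of cycles of $G$ (called balanced) such that no theta subgraph of $G$ contains exactly two cycles in $\mathcal{B}$. An arc of $G$ is a triple $(e,u,v)$, where $e$ is an edge, $u,v$ are vertices incident with $e$, and $u\neq v$ if $e$ is not a loop. For a group $\Gamma$, a $\Gamma$-gaining of $G$ is a function $\gamma$ from the arcs of $G$ to $\Gamma$ with $\gamma(e,v,u)=\gamma(e,u,v)^{ -1}$ for every non-loop edge $e$. The gain of a walk $u_0,e_0,u_1,\ldots,e_{n-1},u_n$ is $\gamma(e_0,u_0,u_1)\cdots\gamma(e_{n-1},u_{n-1},u_n)$. A simple closed walk of a cycle is a closed walk traversing the cycle exactly once; whether its gain is the identity does not depend on starting vertex or direction. Let $\mathcal{B}_\gamma$ be the set of cycles whose simple closed walks have identity gain. $(G,\mathcal{B})$ is $\Gamma$-gainable if there is a $\Gamma$-gaining $\gamma$ of $G$ with $\mathcal{B}=\mathcal{B}_\gamma$. $\mathbb{Z}_n$ is the cyclic group of order $n$ and $\mathbb{Z}_2^2=\mathbb{Z}_2\times\mathbb{Z}_2$.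 -}

module Defs where

open import Algebra.Bundles using (Group)
open import Algebra.Construct.DirectProduct using () renaming (group to _×ᴳ_)
open import Data.Fin using (Fin; toℕ; _≟_)
import Data.Fin.Properties as Fin
open import Data.Fin.Subset using (Subset; Nonempty)
  renaming (_∈_ to _∈ₛ_; _⊆_ to _⊆ₛ_)
open import Data.Fin.Subset.Properties using () renaming (_∈?_ to _∈ₛ?_)
open import Data.List using (List; []; _∷_; [_]; length; filter; allFin)
open import Data.List.Membership.Propositional using (_∈_)
open import Data.List.Relation.Binary.Disjoint.Propositional using (Disjoint)
open import Data.List.Relation.Unary.All using (All)
open import Data.List.Relation.Unary.Unique.Propositional using (Unique)
open import Data.Nat using (ℕ; _+_; _∸_; NonZero; >-nonZero⁻¹)
open import Data.Nat.DivMod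
open import Data.Nat.Properties using (+-assoc; +-comm; m∸n+n≡m; <⇒≤)
open import Data.Product using (_×_; _,_; proj₁; proj₂; ∃-syntax; Σ-syntax)
open import Data.Sum using (_⊎_)
open import Function.Bundles using (_⇔_; Injection)
open import Level using (Level; 0ℓ; _⊔_) renaming (suc to lsuc)
open import Relation.Binary.PropositionalEquality
  using (_≡_; _≢_; sym; trans; cong; cong₂; isEquivalence; module ≡-Reasoning)
open import Relation.Nullary using (¬_)
open import Relation.Nullary.Decidable using (_×-dec_)
open import Relation.Unary using (Pred; _≐_)

private
  variable
    b c ℓ : Level

------------------------------------------------------------------------
-- Graphs

-- The order in which `ends` lists the two ends of an edge carries no
-- meaning.
record Graph : Set where
  field
    #V   : ℕ
    #E   : ℕ
    ends : Fin #E → Fin #V × Fin #V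

  Vertex Edge : Set
  Vertex = Fin #V
  Edge   = Fin #E

  end₁ end₂ : Edge → Vertex
  end₁ e = proj₁ (ends e)
  end₂ e = proj₂ (ends e)

  Incident : Edge → Vertex → Set
  Incident e v = v ≡ end₁ e ⊎ v ≡ end₂ e

  IsLoop : Edge → Set
  IsLoop e = end₁ e ≡ end₂ e

  IsArc : Edge → Vertex → Vertex → Set
  IsArc e u v = Incident e u × Incident e v × (¬ IsLoop e → u ≢ v)

  isArc-sym : ∀ {e u v} → IsArc e u v → IsArc e v u
  isArc-sym (p , q , r) = q , p , λ ¬loop v≡u → r ¬loop (sym v≡u)

module _ (G : Graph) where
  open Graph G

  -- The proof fields of `Arc` and `Subgraph` are irrelevant, so that an
  -- arc is determined by its triple (e , u , v), and a subgraph by its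
  -- vertices and edges.
  record Arc : Set where
    constructor arc
    field
      edge    : Edge
      tail    : Vertex
      head    : Vertex
      .isArc  : IsArc edge tail head

  record Subgraph : Set where
    constructor subgraph
    field
      vertices : Subset #V
      edges    : Subset #E
      .closed  : ∀ {e v} → e ∈ₛ edges → Incident e v → v ∈ₛ vertices

  data Walk : Vertex → Vertex → Set where
    nil  : ∀ {u} → Walk u u
    step : ∀ {u v w} (e : Edge) → .(IsArc e u v) → Walk v w → Walk u w

module _ {G : Graph} where
  open Graph G
  open Subgraph

  reverse : Arc G → Arc G
  reverse (arc e u v p) = arc e v u (isArc-sym p)

  walkVertices : ∀ {u v} → Walk G u v → List Vertex
  walkVertices {u} nil          = [ u ]
  walkVertices {u} (step _ _ w) = u ∷ walkVertices w

  walkEdges : ∀ {u v} → Walk G u v → List Edge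
  walkEdges nil          = []
  walkEdges (step e _ w) = e ∷ walkEdges w

  _⊆ᴳ_ : Subgraph G → Subgraph G → Set
  H ⊆ᴳ K = vertices H ⊆ₛ vertices K × edges H ⊆ₛ edges K

  Connected : Subgraph G → Set
  Connected H =
    ∀ {u v} → u ∈ₛ vertices H → v ∈ₛ vertices H →
    Σ[ w ∈ Walk G u v ] All (_∈ₛ edges H) (walkEdges w)

  -- A loop at v contributes to both summands, and so counts twice.
  degree : Subgraph G → Vertex → ℕ
  degree H v =
    length (filter (λ e → (e ∈ₛ? edges H) ×-dec (end₁ e ≟ v)) (allFin #E)) +
    length (filter (λ e → (e ∈ₛ? edges H) ×-dec (end₂ e ≟ v)) (allFin #E))

  IsCycle : Subgraph G → Set
  IsCycle H =
    Nonempty (vertices H) × Connected H × (∀ {v} → v ∈ₛ vertices H → degree H v ≡ 2)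

  IsPath : ∀ {u v} → Walk G u v → Set
  IsPath w = Unique (walkVertices w)

  -- Sharing no edge has to be required separately: a path consisting of
  -- a single edge has no internal vertices, but must not be used twice.
  InternallyDisjoint : ∀ {u v} → Walk G u v → Walk G u v → Set
  InternallyDisjoint {u} {v} P Q =
    (∀ {x} → x ∈ walkVertices P → x ∈ walkVertices Q → x ≡ u ⊎ x ≡ v) ×
    Disjoint (walkEdges P) (walkEdges Q)

  record IsTheta (H : Subgraph G) : Set where
    field
      {u v}    : Vertex
      u≢v      : u ≢ v
      P Q R    : Walk G u v
      P-path   : IsPath P
      Q-path   : IsPath Q
      R-path   : IsPath R
      PQ       : InternallyDisjoint P Q
      PR       : InternallyDisjoint P R
      QR       : InternallyDisjoint Q R
      vertices-union : ∀ x →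
        x ∈ₛ vertices H ⇔ (x ∈ walkVertices P ⊎ x ∈ walkVertices Q ⊎ x ∈ walkVertices R)
      edges-union : ∀ e →
        e ∈ₛ edges H ⇔ (e ∈ walkEdges P ⊎ e ∈ walkEdges Q ⊎ e ∈ walkEdges R)

  ContainsExactlyTwo : Pred (Subgraph G) b → Subgraph G → Set b
  ContainsExactlyTwo 𝓑 H =
    ∃[ C ] ∃[ D ] C ≢ D × (𝓑 C × C ⊆ᴳ H) × (𝓑 D × D ⊆ᴳ H) ×
      (∀ K → 𝓑 K → K ⊆ᴳ H → K ≡ C ⊎ K ≡ D)

  -- Meant for a cycle C; traversing every edge of C exactly once then
  -- forces every vertex of C to be visited exactly once as well.
  IsSimpleClosedWalk : Subgraph G → ∀ {u} → Walk G u u → Set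
  IsSimpleClosedWalk C w =
    Unique (walkEdges w) × (∀ e → e ∈ₛ edges C ⇔ e ∈ walkEdges w)

record BiasedGraph (b : Level) : Set (lsuc b) where
  field
    graph    : Graph
    Balanced : Pred (Subgraph graph) b
    cycles   : ∀ {C} → Balanced C → IsCycle C
    theta    : ∀ {H} → IsTheta H → ¬ ContainsExactlyTwo Balanced H

------------------------------------------------------------------------
-- Gains

record Gaining (G : Graph) (Γ : Group c ℓ) : Set (c ⊔ ℓ) where
  open Group Γ
  open Graph G
  field
    γ         : Arc G → Carrier
    γ-reverse : ∀ a → ¬ IsLoop (Arc.edge a) → γ (reverse a) ≈ γ a ⁻¹

  gain : ∀ {u v} → Walk G u v → Carrier
  gain nil                      = ε
  gain (step {u} {v} e isArc w) = γ (arc e u v isArc) ∙ gain w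

  𝓑 : Pred (Subgraph G) ℓ
  𝓑 C = IsCycle C × (∀ {u} (w : Walk G u u) → IsSimpleClosedWalk C w → gain w ≈ ε)

Gainable : Group c ℓ → BiasedGraph b → Set (b ⊔ c ⊔ ℓ)
Gainable Γ Ω = Σ[ γ ∈ Gaining graph Γ ] Balanced ≐ Gaining.𝓑 γ
  where open BiasedGraph Ω

------------------------------------------------------------------------
-- Groups

HasSizeAtLeast : ℕ → Group c ℓ → Set (c ⊔ ℓ)
HasSizeAtLeast n Γ = Injection (Fin.≡-setoid n) (Group.setoid Γ)

module _ (n : ℕ) .{{_ : NonZero n}} where

  private
    _⊕_ : Fin n → Fin n → Fin n
    i ⊕ j = (toℕ i + toℕ j) mod n

    ⊖_ : Fin n → Fin n
    ⊖ i = (n ∸ toℕ i) mod n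

    𝟘 : Fin n
    𝟘 = 0 mod n

    toℕ-mod : ∀ m → toℕ (m mod n) ≡ m % n
    toℕ-mod m = Fin.toℕ-fromℕ< (m%n<n m n)

    toℕ-mod-toℕ : ∀ (i : Fin n) → toℕ i mod n ≡ i
    toℕ-mod-toℕ i = Fin.toℕ-injective
      (trans (toℕ-mod (toℕ i)) (m<n⇒m%n≡m (Fin.toℕ<n i)))

    mod-cong : ∀ {k m} → k % n ≡ m % n → k mod n ≡ m mod n
    mod-cong {k} {m} eq = Fin.toℕ-injective
      (trans (toℕ-mod k) (trans eq (sym (toℕ-mod m))))

    absorbˡ : ∀ k m → (k % n + m) % n ≡ (k + m) % n
    absorbˡ k m = begin
      (k % n + m) % n          ≡⟨ %-distribˡ-+ (k % n) m n ⟩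
      (k % n % n + m % n) % n  ≡⟨ cong (λ x → (x + m % n) % n) (m%n%n≡m%n k n) ⟩
      (k % n + m % n) % n      ≡⟨ %-distribˡ-+ k m n ⟨
      (k + m) % n              ∎
      where open ≡-Reasoning

    comm : ∀ i j → i ⊕ j ≡ j ⊕ i
    comm i j = cong (_mod n) (+-comm (toℕ i) (toℕ j))

    mod-⊕ : ∀ k j → (k mod n) ⊕ j ≡ (k + toℕ j) mod n
    mod-⊕ k j = mod-cong (trans (cong (λ x → (x + toℕ j) % n) (toℕ-mod k))
                                (absorbˡ k (toℕ j)))

    assoc : ∀ i j k → (i ⊕ j) ⊕ k ≡ i ⊕ (j ⊕ k)
    assoc i j k = begin
      (i ⊕ j) ⊕ k                        ≡⟨ mod-⊕ (toℕ i + toℕ j) k ⟩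
      ((toℕ i + toℕ j) + toℕ k) mod n    ≡⟨ cong (_mod n) (+-assoc (toℕ i) (toℕ j) (toℕ k)) ⟩
      (toℕ i + (toℕ j + toℕ k)) mod n    ≡⟨ cong (_mod n) (+-comm (toℕ i) (toℕ j + toℕ k)) ⟩
      ((toℕ j + toℕ k) + toℕ i) mod n    ≡⟨ mod-⊕ (toℕ j + toℕ k) i ⟨
      (j ⊕ k) ⊕ i                        ≡⟨ comm (j ⊕ k) i ⟩
      i ⊕ (j ⊕ k)                        ∎
      where open ≡-Reasoning

    identityˡ : ∀ i → 𝟘 ⊕ i ≡ i
    identityˡ i = trans (mod-⊕ 0 i) (toℕ-mod-toℕ i)

    inverseˡ : ∀ i → (⊖ i) ⊕ i ≡ 𝟘
    inverseˡ i = trans (mod-⊕ (n ∸ toℕ i) i)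
      (mod-cong (trans (cong (_% n) (m∸n+n≡m (<⇒≤ (Fin.toℕ<n i))))
                       (trans (n%n≡0 n) (sym (m<n⇒m%n≡m (>-nonZero⁻¹ n))))))

  ℤ/ : Group 0ℓ 0ℓ
  ℤ/ = record
    { Carrier = Fin n
    ; _≈_     = _≡_
    ; _∙_     = _⊕_
    ; ε       = 𝟘
    ; _⁻¹     = ⊖_
    ; isGroup = record
      { isMonoid = record
        { isSemigroup = record
          { isMagma = record { isEquivalence = isEquivalence ; ∙-cong = cong₂ _⊕_ }
          ; assoc   = assoc
          }
        ; identity = identityˡ , λ i → trans (comm i 𝟘) (identityˡ i)
        }
      ; inverse = inverseˡ , λ i → trans (comm i (⊖ i)) (inverseˡ i)
      ; ⁻¹-cong = cong ⊖_
      }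
    }

ℤ₃ ℤ₂² : Group 0ℓ 0ℓ
ℤ₃  = ℤ/ 3
ℤ₂² = ℤ/ 2 ×ᴳ ℤ/ 2

{-# OPTIONS --safe #-}
module Submission where

-- Let φ and ψ be gainings over ℤ₃ and ℤ₂² with the same balanced cycles. The rings 𝔽₃ and 𝔽₄ are
-- the quotients of the Eisenstein integers by √-3 and 2, and the six Eisenstein units correspond
-- to the pairs of nonzero elements. So each cycle C has an element u(C) that is a unit or zero and
-- lifts its pair of gains. After switching so that the edges with trivial gains connect the ends of
-- every edge, lifting the gains of single edges gives a gaining with gain u(C) on every cycle C: a
-- path of trivial edges across C forms a theta subgraph in which the other two cycles have fewer
-- nontrivial edges, and in a theta subgraph u is additive, because x + y is zero or a unit if x, y
-- are units and x + y is zero modulo 2 exactly if it is zero modulo √-3.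
-- Sending 1, ω, ω² to 1, 1, -2 turns the gains of cycles into integers of absolute value at most 2,
-- so the powers of any g with g, g² ≠ 1 give a gaining. A group of size at least three without such
-- an element contains ℤ₂².

open import Defs
open import Algebra.Bundles using (Group; AbelianGroup)
open import Algebra.Construct.DirectProduct using () renaming (group to _×ᴳ_)
import Algebra.Properties.Group as GroupProperties
import Algebra.Properties.Monoid.Mult as Mult
open import Axiom.ExcludedMiddle using (ExcludedMiddle)
open import Data.Bool using (true; false)
open import Data.Empty using (⊥-elim)
open import Data.Fin using (Fin; zero; suc; toℕ; #_; _≟_)
import Data.Fin.Properties as Fin
open import Data.Fin.Subset using (Subset; ⁅_⁆; _∪_)
  renaming (_∈_ to _∈ₛ_; ⊥ to ∅)
open import Data.Fin.Subset.Properties using (x∈⁅x⁆; x∈⁅y⁆⇒x≡y; x∈p∪q⁺; x∈p∪q⁻; ∉⊥)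
  renaming (_∈?_ to _∈ₛ?_)
open import Data.Integer using (ℤ; -[1+_]; _⊖_; ∣_∣) renaming (+_ to pos)
import Data.Integer as ℤ
import Data.Integer.Properties as ℤ
open import Data.List using (List; []; _∷_; [_]; _++_; length; filter; allFin)
open import Data.List.Membership.DecPropositional using () renaming (_∈?_ to member?)
open import Data.List.Membership.Propositional using (_∈_; _∉_; find)
open import Data.List.Membership.Propositional.Properties
  using (∈-++⁺ˡ; ∈-++⁺ʳ; ∈-++⁻; ∈-filter⁺; ∈-filter⁻; ∈-allFin)
open import Data.List.Membership.Propositional.Properties.WithK using (unique∧set⇒bag)
open import Data.List.Properties
  using (filter-some; filter-accept; filter-reject; filter-none; filter-++; length-++)
open import Data.List.Relation.Binary.BagAndSetEquality using (∼bag⇒↭)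
open import Data.List.Relation.Binary.Permutation.Propositional using (_↭_; ↭-sym; ↭⇒↭ₛ)
open import Data.List.Relation.Binary.Permutation.Propositional.Properties
  using (↭-length; ++-comm; ∈-resp-↭)
open import Data.List.Relation.Binary.Permutation.Setoid.Properties using (Unique-resp-↭)
open import Data.List.Relation.Unary.All as All using (All; []; _∷_)
open import Data.List.Relation.Unary.All.Properties as All using (¬Any⇒All¬; All¬⇒¬Any; ¬All⇒Any¬)
open import Data.List.Relation.Unary.AllPairs as AllPairs using ([]; _∷_)
open import Data.List.Relation.Unary.Any as Any using (Any; here; there)
open import Data.List.Relation.Unary.Unique.Propositional using (Unique)
import Data.List.Relation.Unary.Unique.Propositional.Properties as Unique
open import Data.Nat using (ℕ; zero; suc; _+_; _*_; _≤_; _<_; s≤s; NonZero)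
open import Data.Nat.DivMod using (_mod_)
open import Data.Nat.Induction using (<-rec)
import Data.Nat.Properties as ℕ
open import Data.Nat.Solver using (module +-*-Solver)
open import Data.Product using (_×_; _,_; proj₁; proj₂; ∃-syntax; Σ-syntax)
open import Data.Sum using (_⊎_; inj₁; inj₂; [_,_]′)
open import Data.Vec using ([]; _∷_)
open import Function.Base using (_∘_; id)
open import Function.Bundles using (_⇔_; mk⇔; Equivalence; Injection)
open import Level using (Lift; lift; lower; 0ℓ; _⊔_)
open import Relation.Binary.Definitions using () renaming (Decidable to Decidable₂)
open import Relation.Binary.PropositionalEquality
  using (_≡_; _≢_; refl; sym; trans; cong; cong₂; subst; module ≡-Reasoning)
import Relation.Binary.Reasoning.Setoid as SetoidReasoning
open import Relation.Nullary using (¬_; Dec; yes; no; contradiction; recompute; does)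
open import Relation.Nullary.Decidable using (from-yes; _×-dec_; _⊎-dec_; _→-dec_; ¬?)
open import Relation.Unary using (Pred; Decidable)

-- Walks

module _ {G : Graph} where
  open Graph G

  private
    variable
      e : Edge
      u v x y z : Vertex

  isArc? : ∀ e u v → Dec (IsArc e u v)
  isArc? e u v =
    ((u ≟ end₁ e) ⊎-dec (u ≟ end₂ e)) ×-dec ((v ≟ end₁ e) ⊎-dec (v ≟ end₂ e)) ×-dec
    (¬? (end₁ e ≟ end₂ e) →-dec ¬? (u ≟ v))

  -- The arc proof is irrelevant and is recovered from the decidability of `IsArc`. If `u` and `v`
  -- match the same end they are equal, so `e` must be a loop and either end may be named.
  arc-ends : .(IsArc e u v) → (u ≡ end₁ e × v ≡ end₂ e) ⊎ (u ≡ end₂ e × v ≡ end₁ e)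
  arc-ends {e} {u} {v} a with recompute (isArc? e u v) a
  ... | inj₁ p , inj₂ q , _ = inj₁ (p , q)
  ... | inj₂ p , inj₁ q , _ = inj₂ (p , q)
  ... | inj₁ p , inj₁ q , r with end₁ e ≟ end₂ e
  ...   | yes loop = inj₁ (p , trans q loop)
  ...   | no ¬loop = contradiction (trans p (sym q)) (r ¬loop)
  arc-ends {e} {u} {v} a | inj₂ p , inj₂ q , r with end₁ e ≟ end₂ e
  ...   | yes loop = inj₁ (trans p (sym loop) , q)
  ...   | no ¬loop = contradiction (trans p (sym q)) (r ¬loop)

  ends-isArc : ∀ e → IsArc e (end₁ e) (end₂ e)
  ends-isArc e = inj₁ refl , inj₂ refl , id

  arc-tail-incident : .(IsArc e u v) → Incident e u
  arc-tail-incident {e} {u} {v} a = proj₁ (recompute (isArc? e u v) a)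

  arc-head-incident : .(IsArc e u v) → Incident e v
  arc-head-incident {e} {u} {v} a = proj₁ (proj₂ (recompute (isArc? e u v) a))

  arc-incident : .(IsArc e u v) → Incident e z → z ≡ u ⊎ z ≡ v
  arc-incident a i with arc-ends a | i
  ... | inj₁ (refl , refl) | i′     = i′
  ... | inj₂ (refl , refl) | inj₁ p = inj₂ p
  ... | inj₂ (refl , refl) | inj₂ p = inj₁ p

  arc-loop : .(IsArc e u v) → IsLoop e → u ≡ v
  arc-loop a loop with arc-ends a
  ... | inj₁ (refl , refl) = loop
  ... | inj₂ (refl , refl) = sym loop

  same-arc : .(IsArc e u v) → .(IsArc e x y) → (x ≡ u × y ≡ v) ⊎ (x ≡ v × y ≡ u)
  same-arc a b with arc-ends a | arc-ends b
  ... | inj₁ (refl , refl) | inj₁ (refl , refl) = inj₁ (refl , refl)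
  ... | inj₁ (refl , refl) | inj₂ (refl , refl) = inj₂ (refl , refl)
  ... | inj₂ (refl , refl) | inj₁ (refl , refl) = inj₂ (refl , refl)
  ... | inj₂ (refl , refl) | inj₂ (refl , refl) = inj₁ (refl , refl)

  infixr 5 _++ʷ_

  _++ʷ_ : Walk G u v → Walk G v x → Walk G u x
  nil        ++ʷ q = q
  step e a p ++ʷ q = step e a (p ++ʷ q)

  reverseʷ : Walk G u v → Walk G v u
  reverseʷ nil                  = nil
  reverseʷ (step {u} {v} e a w) = reverseʷ w ++ʷ step e (isArc-sym {e} {u} {v} a) nil

  first∈ : (w : Walk G u v) → u ∈ walkVertices w
  first∈ nil          = here refl
  first∈ (step _ _ _) = here refl

  last∈ : (w : Walk G u v) → v ∈ walkVertices w
  last∈ nil          = here refl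
  last∈ (step _ _ w) = there (last∈ w)

  walkEdges-++ʷ : (p : Walk G u v) (q : Walk G v x) →
    walkEdges (p ++ʷ q) ≡ walkEdges p ++ walkEdges q
  walkEdges-++ʷ nil          q = refl
  walkEdges-++ʷ (step e _ p) q = cong (e ∷_) (walkEdges-++ʷ p q)

  ∈-walkEdges-++ʷ⁻ : (p : Walk G u v) (q : Walk G v x) →
    e ∈ walkEdges (p ++ʷ q) → e ∈ walkEdges p ⊎ e ∈ walkEdges q
  ∈-walkEdges-++ʷ⁻ p q i rewrite walkEdges-++ʷ p q = ∈-++⁻ (walkEdges p) i

  ∈-walkEdges-++ʷ⁺ˡ : (p : Walk G u v) (q : Walk G v x) →
    e ∈ walkEdges p → e ∈ walkEdges (p ++ʷ q)
  ∈-walkEdges-++ʷ⁺ˡ p q i rewrite walkEdges-++ʷ p q = ∈-++⁺ˡ i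

  ∈-walkEdges-++ʷ⁺ʳ : (p : Walk G u v) (q : Walk G v x) →
    e ∈ walkEdges q → e ∈ walkEdges (p ++ʷ q)
  ∈-walkEdges-++ʷ⁺ʳ p q i rewrite walkEdges-++ʷ p q = ∈-++⁺ʳ (walkEdges p) i

  ∈-walkVertices-++ʷ⁻ : (p : Walk G u v) (q : Walk G v x) →
    z ∈ walkVertices (p ++ʷ q) → z ∈ walkVertices p ⊎ z ∈ walkVertices q
  ∈-walkVertices-++ʷ⁻ nil          q i           = inj₂ i
  ∈-walkVertices-++ʷ⁻ (step e a p) q (here eq)   = inj₁ (here eq)
  ∈-walkVertices-++ʷ⁻ (step e a p) q (there i)   with ∈-walkVertices-++ʷ⁻ p q i
  ... | inj₁ j = inj₁ (there j)
  ... | inj₂ j = inj₂ j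

  ∈-walkVertices-++ʷ⁺ʳ : (p : Walk G u v) (q : Walk G v x) →
    z ∈ walkVertices q → z ∈ walkVertices (p ++ʷ q)
  ∈-walkVertices-++ʷ⁺ʳ nil          q i = i
  ∈-walkVertices-++ʷ⁺ʳ (step _ _ p) q i = there (∈-walkVertices-++ʷ⁺ʳ p q i)

  ∈-walkVertices-++ʷ⁺ˡ : (p : Walk G u v) (q : Walk G v x) →
    z ∈ walkVertices p → z ∈ walkVertices (p ++ʷ q)
  ∈-walkVertices-++ʷ⁺ˡ nil          q (here refl) = first∈ q
  ∈-walkVertices-++ʷ⁺ˡ (step _ _ p) q (here eq)   = here eq
  ∈-walkVertices-++ʷ⁺ˡ (step _ _ p) q (there i)   = there (∈-walkVertices-++ʷ⁺ˡ p q i)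

  incident∈ : (w : Walk G u v) → e ∈ walkEdges w → Incident e z → z ∈ walkVertices w
  incident∈ (step e a w) (here refl) i with arc-incident a i
  ... | inj₁ refl = here refl
  ... | inj₂ refl = there (first∈ w)
  incident∈ (step e a w) (there j)   i = there (incident∈ w j i)

  -- The explicit first step matters, as a walk without steps visits a vertex but has no edge.
  -- Through this, the edges of a cycle control the vertices of a walk around it.
  vertex-incident : ∀ {e} .(a : IsArc e u v) (p : Walk G v x) → z ∈ walkVertices (step e a p) →
    ∃[ e′ ] e′ ∈ walkEdges (step e a p) × Incident e′ z
  vertex-incident a p             (here refl)         = _ , here refl , arc-tail-incident a
  vertex-incident a nil           (there (here refl)) = _ , here refl , arc-head-incident a
  vertex-incident a (step _ b p)  (there i)           with vertex-incident b p i
  ... | e′ , j , k = e′ , there j , k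

  ∈-walkEdges-reverseʷ⁻ : (w : Walk G u v) → e ∈ walkEdges (reverseʷ w) → e ∈ walkEdges w
  ∈-walkEdges-reverseʷ⁻ (step e a w) i with ∈-walkEdges-++ʷ⁻ (reverseʷ w) _ i
  ... | inj₁ j           = there (∈-walkEdges-reverseʷ⁻ w j)
  ... | inj₂ (here refl) = here refl

  ∈-walkEdges-reverseʷ⁺ : (w : Walk G u v) → e ∈ walkEdges w → e ∈ walkEdges (reverseʷ w)
  ∈-walkEdges-reverseʷ⁺ (step e a w) (here refl) = ∈-walkEdges-++ʷ⁺ʳ (reverseʷ w) _ (here refl)
  ∈-walkEdges-reverseʷ⁺ (step e a w) (there i)   =
    ∈-walkEdges-++ʷ⁺ˡ (reverseʷ w) _ (∈-walkEdges-reverseʷ⁺ w i)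

  all-++ʷ : ∀ {ℓ} {P : Edge → Set ℓ} (p : Walk G u v) (q : Walk G v x) →
    All P (walkEdges p) → All P (walkEdges q) → All P (walkEdges (p ++ʷ q))
  all-++ʷ p q ps qs rewrite walkEdges-++ʷ p q = All.++⁺ ps qs

  all-reverseʷ : ∀ {ℓ} {P : Edge → Set ℓ} (w : Walk G u v) →
    All P (walkEdges w) → All P (walkEdges (reverseʷ w))
  all-reverseʷ w ps = All.tabulate (All.lookup ps ∘ ∈-walkEdges-reverseʷ⁻ w)

  ∈-walkVertices-reverseʷ⁻ : (w : Walk G u v) → z ∈ walkVertices (reverseʷ w) → z ∈ walkVertices w
  ∈-walkVertices-reverseʷ⁻ nil          i = i
  ∈-walkVertices-reverseʷ⁻ (step e a w) i with ∈-walkVertices-++ʷ⁻ (reverseʷ w) _ i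
  ... | inj₁ j                    = there (∈-walkVertices-reverseʷ⁻ w j)
  ... | inj₂ (here refl)          = there (first∈ w)
  ... | inj₂ (there (here refl))  = here refl

  split-vertex : (w : Walk G u v) → z ∈ walkVertices w →
    Σ[ p ∈ Walk G u z ] Σ[ q ∈ Walk G z v ] w ≡ p ++ʷ q
  split-vertex nil          (here refl) = nil , nil , refl
  split-vertex (step e a w) (here refl) = nil , step e a w , refl
  split-vertex (step e a w) (there i)   with split-vertex w i
  ... | p , q , refl = step e a p , q , refl

  -- A record instead of nested Σ-types, so that the arc proof stays irrelevant as it is in `step`.
  record EdgeSplit (e : Edge) (w : Walk G u v) : Set where
    constructor edgeSplit
    field
      {x₁ x₂} : Vertex
      before  : Walk G u x₁
      .isArc  : IsArc e x₁ x₂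
      after   : Walk G x₂ v
      split   : w ≡ before ++ʷ step e isArc after

  split-edge : (w : Walk G u v) → e ∈ walkEdges w → EdgeSplit e w
  split-edge (step e a w) (here refl) =
    edgeSplit nil a w refl
  split-edge (step e a w) (there i) with split-edge w i
  ... | edgeSplit p b q refl = edgeSplit (step e a p) b q refl

  -- Paths

  path-step : .{a : IsArc e u v} {w : Walk G v x} →
    u ∉ walkVertices w → IsPath w → IsPath (step e a w)
  path-step u∉ path = ¬Any⇒All¬ _ u∉ ∷ path

  path-++ʷ⁺ : (p : Walk G u v) (q : Walk G v x) → IsPath p → IsPath q →
    (∀ {z} → z ∈ walkVertices p → z ∈ walkVertices q → z ≡ v) → IsPath (p ++ʷ q)
  path-++ʷ⁺ nil              q _           path′ _    = path′
  path-++ʷ⁺ (step {u} e a p) q (u∉ ∷ path) path′ meet =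
    ¬Any⇒All¬ _ u∉pq ∷ path-++ʷ⁺ p q path path′ (meet ∘ there)
    where
    u∉pq : u ∉ walkVertices (p ++ʷ q)
    u∉pq i with ∈-walkVertices-++ʷ⁻ p q i
    ... | inj₁ j = All¬⇒¬Any u∉ j
    ... | inj₂ j with meet (here refl) j
    ...   | refl = All¬⇒¬Any u∉ (last∈ p)

  path-++ʷ⁻ˡ : (p : Walk G u v) (q : Walk G v x) → IsPath (p ++ʷ q) → IsPath p
  path-++ʷ⁻ˡ nil          q _           = [] ∷ []
  path-++ʷ⁻ˡ (step _ _ p) q (u∉ ∷ path) =
    ¬Any⇒All¬ _ (All¬⇒¬Any u∉ ∘ ∈-walkVertices-++ʷ⁺ˡ p q) ∷ path-++ʷ⁻ˡ p q path

  path-++ʷ⁻ʳ : (p : Walk G u v) (q : Walk G v x) → IsPath (p ++ʷ q) → IsPath q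
  path-++ʷ⁻ʳ nil          q path       = path
  path-++ʷ⁻ʳ (step _ _ p) q (_ ∷ path) = path-++ʷ⁻ʳ p q path

  path-++ʷ⁻-meet : (p : Walk G u v) (q : Walk G v x) → IsPath (p ++ʷ q) →
    ∀ {z} → z ∈ walkVertices p → z ∈ walkVertices q → z ≡ v
  path-++ʷ⁻-meet nil          q _          (here refl) j = refl
  path-++ʷ⁻-meet (step _ _ p) q (u∉ ∷ _)   (here refl) j =
    ⊥-elim (All¬⇒¬Any u∉ (∈-walkVertices-++ʷ⁺ʳ p q j))
  path-++ʷ⁻-meet (step _ _ p) q (_ ∷ path) (there i)   j = path-++ʷ⁻-meet p q path i j

  path-reverseʷ : (w : Walk G u v) → IsPath w → IsPath (reverseʷ w)
  path-reverseʷ nil          path                        = path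
  path-reverseʷ (step {u} {v} e a w) (u∉ ∷ path) =
    path-++ʷ⁺ (reverseʷ w) _ (path-reverseʷ w path)
      (((λ v≡u → All¬⇒¬Any u∉ (subst (_∈ _) v≡u (first∈ w))) ∷ []) ∷ [] ∷ [])
      λ { i (here eq)           → eq
        ; i (there (here refl)) → ⊥-elim (All¬⇒¬Any u∉ (∈-walkVertices-reverseʷ⁻ w i)) }

  path-edges-unique : (w : Walk G u v) → IsPath w → Unique (walkEdges w)
  path-edges-unique nil          _           = []
  path-edges-unique (step e a w) (u∉ ∷ path) =
    ¬Any⇒All¬ _ (λ i → All¬⇒¬Any u∉ (incident∈ w i (arc-tail-incident a))) ∷ path-edges-unique w path

  -- In a path the edge towards the next vertex is the only one at the present vertex.
  trail-in-path : (p q : Walk G u v) → IsPath p → Unique (walkEdges q) →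
    (∀ {e} → e ∈ walkEdges q → e ∈ walkEdges p) → q ≡ p
  trail-in-path nil nil          _ _ _   = refl
  trail-in-path nil (step _ _ _) _ _ q⊆p with () ← q⊆p (here refl)
  trail-in-path (step e a p) nil          (u∉ ∷ _)    _ _ = ⊥-elim (All¬⇒¬Any u∉ (last∈ p))
  trail-in-path (step e a p) (step f b q) (u∉ ∷ path) (f∉ ∷ uniq) q⊆p with q⊆p (here refl)
  ... | there i   = ⊥-elim (All¬⇒¬Any u∉ (incident∈ p i (arc-tail-incident b)))
  ... | here refl with same-arc a b
  ...   | inj₂ (refl , refl) = ⊥-elim (All¬⇒¬Any u∉ (first∈ p))
  ...   | inj₁ (refl , refl) = cong (step _ _) (trail-in-path p q path uniq λ i → tail⊆ i (q⊆p (there i)))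
    where
    tail⊆ : ∀ {e′} → e′ ∈ walkEdges q → e′ ∈ _ ∷ walkEdges p → e′ ∈ walkEdges p
    tail⊆ i (here refl) = ⊥-elim (All¬⇒¬Any f∉ i)
    tail⊆ _ (there j)   = j

-- Circuits and cycles

fromList : ∀ {n} → List (Fin n) → Subset n
fromList []       = ∅
fromList (x ∷ xs) = ⁅ x ⁆ ∪ fromList xs

∈-fromList⁺ : ∀ {n} {x : Fin n} {xs} → x ∈ xs → x ∈ₛ fromList xs
∈-fromList⁺ (here refl) = x∈p∪q⁺ (inj₁ (x∈⁅x⁆ _))
∈-fromList⁺ (there i)   = x∈p∪q⁺ (inj₂ (∈-fromList⁺ i))

∈-fromList⁻ : ∀ {n} {x : Fin n} xs → x ∈ₛ fromList xs → x ∈ xs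
∈-fromList⁻ []       i = ⊥-elim (∉⊥ i)
∈-fromList⁻ (y ∷ xs) i with x∈p∪q⁻ ⁅ y ⁆ (fromList xs) i
... | inj₁ j = here (x∈⁅y⁆⇒x≡y y j)
... | inj₂ j = there (∈-fromList⁻ xs j)

-- Counting occurrences in lists

occ : ∀ {n} → Fin n → List (Fin n) → ℕ
occ z xs = length (filter (_≟ z) xs)

length-filter-∷ : ∀ {a p} {A : Set a} {P : Pred A p} (P? : Decidable P) x xs →
  length (filter P? (x ∷ xs)) ≡ length (filter P? [ x ]) + length (filter P? xs)
length-filter-∷ P? x xs with does (P? x)
... | true  = refl
... | false = refl

occ-self : ∀ {n} (z : Fin n) xs → occ z (z ∷ xs) ≡ suc (occ z xs)
occ-self z xs = cong length (filter-accept (_≟ z) refl)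

occ-∈ : ∀ {n} {z : Fin n} {xs} → z ∈ xs → 0 < occ z xs
occ-∈ {z = z} i = filter-some (_≟ z) (Any.map sym i)

occ-unique : ∀ {n} {z : Fin n} {xs} → Unique xs → z ∈ xs → occ z xs ≡ 1
occ-unique {z = z} {xs = x ∷ xs} (x∉ ∷ _) (here refl) = begin
  occ z (z ∷ xs)  ≡⟨ occ-self z xs ⟩
  suc (occ z xs)  ≡⟨ cong (suc ∘ length) (filter-none (_≟ z) (All.map (_∘ sym) x∉)) ⟩
  1               ∎
  where open ≡-Reasoning
occ-unique {z = z} {xs = x ∷ xs} (x∉ ∷ uniq) (there i) with x ≟ z
... | yes refl = ⊥-elim (All¬⇒¬Any x∉ i)
... | no _     = occ-unique uniq i

occ≡1⇒unique : ∀ {n} (xs : List (Fin n)) → (∀ {z} → z ∈ xs → occ z xs ≡ 1) → Unique xs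
occ≡1⇒unique []       _    = []
occ≡1⇒unique (x ∷ xs) once = ¬Any⇒All¬ xs x∉xs ∷ occ≡1⇒unique xs once′
  where
  x∉xs : x ∉ xs
  x∉xs i with occ x xs | occ-∈ i | trans (sym (occ-self x xs)) (once (here refl))
  ... | suc _ | _ | ()

  once′ : ∀ {z} → z ∈ xs → occ z xs ≡ 1
  once′ {z} i with x ≟ z | once (there i)
  ... | yes refl | _ = ⊥-elim (x∉xs i)
  ... | no _     | p = p

module _ {G : Graph} where
  open Graph G
  open Subgraph

  private
    variable
      e : Edge
      u v x y z : Vertex

  walkSubgraph : Walk G u v → Subgraph G
  walkSubgraph w = subgraph (fromList (walkVertices w)) (fromList (walkEdges w))
    λ i inc → ∈-fromList⁺ (incident∈ w (∈-fromList⁻ (walkEdges w) i) inc)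

  -- Degrees counted along walks

  endCount : Vertex → List Edge → ℕ
  endCount z es = length (filter (λ e → end₁ e ≟ z) es) + length (filter (λ e → end₂ e ≟ z) es)

  -- Filtering either enumeration of the edges of `H` gives duplicate-free lists with the same
  -- elements, hence permutations of each other. Degrees can then be counted along a walk.
  degree-edges : (H : Subgraph G) (es : List Edge) → Unique es →
    (∀ e → e ∈ₛ edges H ⇔ e ∈ es) → ∀ z → degree H z ≡ endCount z es
  degree-edges H es uniq E⇔es z =
    cong₂ _+_ (count (λ e → end₁ e ≟ z)) (count (λ e → end₂ e ≟ z))
    where
    count : ∀ {p} {P : Pred Edge p} (P? : Decidable P) →
      length (filter (λ e → (e ∈ₛ? edges H) ×-dec P? e) (allFin #E)) ≡ length (filter P? es)
    count P? = ↭-length (∼bag⇒↭ (unique∧set⇒bag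
      (Unique.filter⁺ EP? (Unique.allFin⁺ #E)) (Unique.filter⁺ P? uniq)
      (mk⇔ to from)))
      where
      EP? = λ e → (e ∈ₛ? edges H) ×-dec P? e
      to : ∀ {e} → e ∈ filter EP? (allFin #E) → e ∈ filter P? es
      to i with ∈-filter⁻ EP? {xs = allFin #E} i
      ... | _ , e∈E , Pe = ∈-filter⁺ P? (Equivalence.to (E⇔es _) e∈E) Pe
      from : ∀ {e} → e ∈ filter P? es → e ∈ filter EP? (allFin #E)
      from i with ∈-filter⁻ P? {xs = es} i
      ... | e∈es , Pe = ∈-filter⁺ EP? (∈-allFin _) (Equivalence.from (E⇔es _) e∈es , Pe)

  endCount-∷ : ∀ z es .(a : IsArc e u v) →
    endCount z (e ∷ es) ≡ occ z [ u ] + occ z [ v ] + endCount z es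
  endCount-∷ {e} {u} {v} z es a = begin
    endCount z (e ∷ es)
      ≡⟨ cong₂ _+_ (length-filter-∷ (λ e → end₁ e ≟ z) e es) (length-filter-∷ (λ e → end₂ e ≟ z) e es) ⟩
    (n₁ + m₁) + (n₂ + m₂)
      ≡⟨ solve 4 (λ n₁ m₁ n₂ m₂ → (n₁ :+ m₁) :+ (n₂ :+ m₂) := n₁ :+ n₂ :+ (m₁ :+ m₂)) refl n₁ m₁ n₂ m₂ ⟩
    n₁ + n₂ + endCount z es
      ≡⟨ cong (_+ endCount z es) (trans (cong₂ _+_ (single end₁) (single end₂)) (swap (arc-ends {G} {e} a))) ⟩
    occ z [ u ] + occ z [ v ] + endCount z es ∎
    where
    open ≡-Reasoning
    open +-*-Solver
    n₁ = length (filter (λ e → end₁ e ≟ z) [ e ])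
    n₂ = length (filter (λ e → end₂ e ≟ z) [ e ])
    m₁ = length (filter (λ e → end₁ e ≟ z) es)
    m₂ = length (filter (λ e → end₂ e ≟ z) es)
    single : (end : Edge → Vertex) → length (filter (λ e → end e ≟ z) [ e ]) ≡ occ z [ end e ]
    single end with does (end e ≟ z)
    ... | true  = refl
    ... | false = refl
    swap : ∀ {u v} → (u ≡ end₁ e × v ≡ end₂ e) ⊎ (u ≡ end₂ e × v ≡ end₁ e) →
      occ z [ end₁ e ] + occ z [ end₂ e ] ≡ occ z [ u ] + occ z [ v ]
    swap (inj₁ (refl , refl)) = refl
    swap (inj₂ (refl , refl)) = ℕ.+-comm (occ z [ end₁ e ]) _

  -- Every visit to `z` lies between two edge ends, except that the initial and the final vertex of
  -- the walk lack one each; the added terms supply these.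
  endCount-walk : ∀ z (w : Walk G u v) →
    endCount z (walkEdges w) + (occ z [ u ] + occ z [ v ]) ≡ 2 * occ z (walkVertices w)
  endCount-walk {u} z nil = solve 1 (λ n → n :+ n := con 2 :* n) refl (occ z [ u ])
    where open +-*-Solver
  endCount-walk {u} {v} z (step {v = x} e a w) = begin
    endCount z (e ∷ walkEdges w) + (o u + o v)
      ≡⟨ cong (_+ (o u + o v)) (endCount-∷ z (walkEdges w) a) ⟩
    o u + o x + endCount z (walkEdges w) + (o u + o v)
      ≡⟨ solve 4 (λ a b c d → a :+ b :+ c :+ (a :+ d) := con 2 :* a :+ (c :+ (b :+ d))) refl
           (o u) (o x) (endCount z (walkEdges w)) (o v) ⟩
    2 * o u + (endCount z (walkEdges w) + (o x + o v))
      ≡⟨ cong (λ k → 2 * o u + k) (endCount-walk z w) ⟩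
    2 * o u + 2 * occ z (walkVertices w)
      ≡⟨ ℕ.*-distribˡ-+ 2 (o u) _ ⟨
    2 * (o u + occ z (walkVertices w))
      ≡⟨ cong (2 *_) (length-filter-∷ (_≟ z) u (walkVertices w)) ⟨
    2 * occ z (u ∷ walkVertices w) ∎
    where
    open ≡-Reasoning
    open +-*-Solver
    o : Vertex → ℕ
    o x = occ z [ x ]

  -- The two ends of the closing edge `e` are exactly the terms that `endCount-walk` adds for `p`.
  degree-closed : (H : Subgraph G) .(a : IsArc e u v) (p : Walk G v u) →
    IsSimpleClosedWalk H (step e a p) → ∀ z → degree H z ≡ 2 * occ z (walkVertices p)
  degree-closed {e} {u} {v} H a p (uniq , E⇔) z = begin
    degree H z                                           ≡⟨ degree-edges H _ uniq E⇔ z ⟩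
    endCount z (e ∷ walkEdges p)                         ≡⟨ endCount-∷ z (walkEdges p) a ⟩
    occ z [ u ] + occ z [ v ] + endCount z (walkEdges p) ≡⟨ ℕ.+-comm (occ z [ u ] + occ z [ v ]) _ ⟩
    endCount z (walkEdges p) + (occ z [ u ] + occ z [ v ])
      ≡⟨ cong (endCount z (walkEdges p) +_) (ℕ.+-comm (occ z [ u ]) _) ⟩
    endCount z (walkEdges p) + (occ z [ v ] + occ z [ u ]) ≡⟨ endCount-walk z p ⟩
    2 * occ z (walkVertices p)                           ∎
    where open ≡-Reasoning

  -- p visits every vertex of the closed walk that traverses e and then p, so its
  -- being a path says that the closed walk repeats no vertex.
  IsCircuit : Edge → Walk G v u → Set
  IsCircuit e p = IsPath p × e ∉ walkEdges p

  circuit-simple : .(a : IsArc e u v) (p : Walk G v u) → IsCircuit e p →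
    IsSimpleClosedWalk (walkSubgraph (step e a p)) (step e a p)
  circuit-simple a p (path , e∉p) =
    ¬Any⇒All¬ _ e∉p ∷ path-edges-unique p path ,
    λ e → mk⇔ (∈-fromList⁻ _) ∈-fromList⁺

  -- From one visited vertex, go back to the start and then forward to the other.
  walkSubgraph-connected : (w : Walk G u v) → Connected (walkSubgraph w)
  walkSubgraph-connected w {x} {y} i j
    with split-vertex w (∈-fromList⁻ _ i) | split-vertex w (∈-fromList⁻ _ j)
  ... | p , q , refl | p′ , q′ , eq =
    reverseʷ p ++ʷ p′ , All.tabulate λ k → ∈-fromList⁺
      ([ ∈-walkEdges-++ʷ⁺ˡ p q ∘ ∈-walkEdges-reverseʷ⁻ p
       , (λ l → subst (λ w → _ ∈ walkEdges w) (sym eq) (∈-walkEdges-++ʷ⁺ˡ p′ q′ l)) ]′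
       (∈-walkEdges-++ʷ⁻ (reverseʷ p) p′ k))

  circuit-cycle : .(a : IsArc e u v) (p : Walk G v u) → IsCircuit e p →
    IsCycle (walkSubgraph (step e a p))
  circuit-cycle {e} {u} a p circ@(path , _) =
    (_ , ∈-fromList⁺ (first∈ (step e a p))) ,
    walkSubgraph-connected (step e a p) ,
    λ {z} i → trans (degree-closed (walkSubgraph (step e a p)) a p (circuit-simple a p circ) z)
                (cong (2 *_) (occ-unique path (on-p (∈-fromList⁻ _ i))))
    where
    on-p : ∀ {z} → z ∈ u ∷ walkVertices p → z ∈ walkVertices p
    on-p (here refl) = last∈ p
    on-p (there i)   = i

  -- By `degree-closed`, degree 2 everywhere on `C` means that `p` visits each of its vertices
  -- exactly once.
  cycle-circuit : (C : Subgraph G) → IsCycle C → .(a : IsArc e u v) (p : Walk G v u) →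
    IsSimpleClosedWalk C (step e a p) → IsCircuit e p
  cycle-circuit {e} {u} C@(subgraph Vs Es closed) (_ , _ , deg) a p simple@(e∉ ∷ _ , E⇔) =
    occ≡1⇒unique _ (λ {z} i → ℕ.*-cancelˡ-≡ _ _ 2
      (trans (sym (degree-closed C a p simple z)) (deg (on-C (there i))))) ,
    All¬⇒¬Any e∉
    where
    on-C : ∀ {z} → z ∈ u ∷ walkVertices p → z ∈ₛ Vs
    on-C {z} i with vertex-incident {e = e} a p i
    ... | f , f∈ , inc = recompute (z ∈ₛ? Vs) (closed (Equivalence.from (E⇔ f) f∈) inc)

  -- A walk without steps would leave `C` without edges, and so with degree 0 at its vertices.
  cycle-walk-nonempty : (C : Subgraph G) → IsCycle C → ∀ {u} → ¬ IsSimpleClosedWalk C (nil {u = u})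
  cycle-walk-nonempty C ((z , z∈) , _ , deg) (uniq , E⇔)
    with () ← trans (sym (degree-edges C [] uniq E⇔ z)) (deg z∈)

-- Gains

module _ {G : Graph} {c ℓ} {Γ : Group c ℓ} (Φ : Gaining G Γ) where
  open Graph G
  open Group Γ hiding (refl; sym; trans)
  private module Γ = Group Γ
  open GroupProperties Γ
  open Gaining Φ

  private
    variable
      e : Edge
      u v x z : Vertex

  gain-++ʷ : (p : Walk G u v) (q : Walk G v x) → gain (p ++ʷ q) ≈ gain p ∙ gain q
  gain-++ʷ nil          q = Γ.sym (identityˡ _)
  gain-++ʷ (step e a p) q = Γ.trans (∙-congˡ (gain-++ʷ p q)) (Γ.sym (assoc _ _ _))

  -- The rule `γ-reverse` speaks only of edges that are not loops, and a path traverses no loop.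
  gain-reverse-path : (p : Walk G u v) → IsPath p → gain (reverseʷ p) ≈ gain p ⁻¹
  gain-reverse-path nil                  _           = Γ.sym ε⁻¹≈ε
  gain-reverse-path (step {u} {v} e a p) (u∉ ∷ path) = begin
    gain (reverseʷ p ++ʷ step e _ nil)  ≈⟨ gain-++ʷ (reverseʷ p) _ ⟩
    gain (reverseʷ p) ∙ (γ (reverse (arc e u v a)) ∙ ε)
      ≈⟨ ∙-cong (gain-reverse-path p path) (Γ.trans (identityʳ _) (γ-reverse _ ¬loop)) ⟩
    gain p ⁻¹ ∙ γ (arc e u v a) ⁻¹      ≈⟨ ⁻¹-anti-homo-∙ _ _ ⟨
    gain (step e a p) ⁻¹                ∎
    where
    open SetoidReasoning setoid
    ¬loop : ¬ IsLoop e
    ¬loop loop = All¬⇒¬Any u∉ (subst (_∈ walkVertices p) (sym (arc-loop {G} {e} a loop)) (first∈ p))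

  Null : Edge → Set ℓ
  Null e = γ (arc e (end₁ e) (end₂ e) (ends-isArc {G} e)) ≈ ε

  -- `Null` tests one orientation. The other one has the inverse gain or, for a loop, is the same
  -- arc.
  null-arc : ∀ {e} → Null e → .(a : IsArc e u v) → γ (arc e u v a) ≈ ε
  null-arc {e = e} null a with arc-ends {G} {e} a
  ... | inj₁ (refl , refl) = null
  ... | inj₂ (refl , refl) with end₁ e ≟ end₂ e
  ...   | no ¬loop = Γ.trans (γ-reverse _ ¬loop) (Γ.trans (⁻¹-cong null) ε⁻¹≈ε)
  ...   | yes loop = loop-case loop null _
    where
    loop-case : ∀ {x y} → x ≡ y → .{a : IsArc e x y} → γ (arc e x y a) ≈ ε →
      .(b : IsArc e y x) → γ (arc e y x b) ≈ ε
    loop-case refl null _ = null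

  null-gain : (w : Walk G u v) → All Null (walkEdges w) → gain w ≈ ε
  null-gain nil          []            = Γ.refl
  null-gain (step e a w) (null ∷ nulls) =
    Γ.trans (∙-cong (null-arc null a) (null-gain w nulls)) (identityˡ ε)

-- Images and pairs of gainings

module _ {G : Graph} {c ℓ c′ ℓ′} {Γ : Group c ℓ} {Δ : Group c′ ℓ′} where
  private
    module Γ = Group Γ
    module Δ = Group Δ
  open Gaining

  -- Applied arc by arc, `f` has to respect inverses. Gains of walks are a separate matter, since
  -- the map to the integers used later is only partially additive.
  mapGaining : (f : Γ.Carrier → Δ.Carrier) → (∀ {x y} → x Γ.≈ y → f x Δ.≈ f y) →
    (∀ x → f (x Γ.⁻¹) Δ.≈ f x Δ.⁻¹) → Gaining G Γ → Gaining G Δ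
  mapGaining f f-cong f-⁻¹ Φ .γ a               = f (γ Φ a)
  mapGaining f f-cong f-⁻¹ Φ .γ-reverse a ¬loop = Δ.trans (f-cong (γ-reverse Φ a ¬loop)) (f-⁻¹ _)

  pairGaining : Gaining G Γ → Gaining G Δ → Gaining G (Γ ×ᴳ Δ)
  pairGaining Φ Ψ .γ a               = γ Φ a , γ Ψ a
  pairGaining Φ Ψ .γ-reverse a ¬loop = γ-reverse Φ a ¬loop , γ-reverse Ψ a ¬loop

  gain-pair : ∀ Φ Ψ {u v} (w : Walk G u v) → gain (pairGaining Φ Ψ) w ≡ (gain Φ w , gain Ψ w)
  gain-pair Φ Ψ nil          = refl
  gain-pair Φ Ψ (step e a w) = cong (λ g → γ Φ _ Γ.∙ proj₁ g , γ Ψ _ Δ.∙ proj₂ g) (gain-pair Φ Ψ w)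

-- Closed walks around one cycle, in an abelian group

module _ {G : Graph} {c ℓ} (A : AbelianGroup c ℓ) (Φ : Gaining G (AbelianGroup.group A)) where
  open Graph G
  open AbelianGroup A hiding (refl; sym; trans)
  private module A = AbelianGroup A
  open import Algebra.Properties.AbelianGroup A using (⁻¹-∙-comm; ε⁻¹≈ε)
  open Gaining Φ
  open SetoidReasoning setoid

  private
    variable
      e : Edge
      u v z : Vertex

  -- Rotate `w` to start with `e`, which changes no gain in an abelian group. The rest is a trail
  -- within the edges of the path `p`, so by `trail-in-path` it is `p` or its reverse.
  simple-closed-walk-gain : .(a : IsArc e u v) (p : Walk G v u) → IsCircuit e p →
    (w : Walk G z z) → IsSimpleClosedWalk (walkSubgraph (step e a p)) w →
    gain w ≈ gain (step e a p) ⊎ gain w ≈ gain (step e a p) ⁻¹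
  simple-closed-walk-gain {e = e} {u} {v} a p (path , e∉p) w (uniq , E⇔)
    with split-edge w (Equivalence.to (E⇔ e) (∈-fromList⁺ {xs = e ∷ walkEdges p} (here refl)))
  ... | edgeSplit {x₁} {x₂} r b q refl = orient (same-arc {G} {e} a b)
    where
    edges-rotate : walkEdges (r ++ʷ step e b q) ↭ e ∷ walkEdges (q ++ʷ r)
    edges-rotate rewrite walkEdges-++ʷ r (step e b q) | walkEdges-++ʷ q r =
      ++-comm (walkEdges r) (e ∷ walkEdges q)

    uniq′ : Unique (e ∷ walkEdges (q ++ʷ r))
    uniq′ = Unique-resp-↭ (Fin.≡-setoid #E) (↭⇒↭ₛ edges-rotate) uniq

    qr⊆p : ∀ {f} → f ∈ walkEdges (q ++ʷ r) → f ∈ walkEdges p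
    qr⊆p {f} i
      with ∈-fromList⁻ (e ∷ walkEdges p)
             (Equivalence.from (E⇔ f) (∈-resp-↭ (↭-sym edges-rotate) (there i)))
    ... | there j   = j
    ... | here refl = ⊥-elim (All¬⇒¬Any (AllPairs.head uniq′) i)

    rotated : gain (r ++ʷ step e b q) ≈ γ (arc e x₁ x₂ b) ∙ gain (q ++ʷ r)
    rotated = begin
      gain (r ++ʷ step e b q)                  ≈⟨ gain-++ʷ Φ r (step e b q) ⟩
      gain r ∙ (γ (arc e x₁ x₂ b) ∙ gain q)    ≈⟨ comm _ _ ⟩
      γ (arc e x₁ x₂ b) ∙ gain q ∙ gain r      ≈⟨ assoc _ _ _ ⟩
      γ (arc e x₁ x₂ b) ∙ (gain q ∙ gain r)    ≈⟨ ∙-congˡ (gain-++ʷ Φ q r) ⟨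
      γ (arc e x₁ x₂ b) ∙ gain (q ++ʷ r)       ∎

    along : ∀ {x y} .(b : IsArc e x y) (s : Walk G y x) → x ≡ u → y ≡ v →
      Unique (walkEdges s) → (∀ {f} → f ∈ walkEdges s → f ∈ walkEdges p) →
      γ (arc e x y b) ∙ gain s ≈ gain (step e a p)
    along b s refl refl uniq s⊆p with refl ← trail-in-path p s path uniq s⊆p = A.refl

    against : ∀ {x y} .(b : IsArc e x y) (s : Walk G y x) → x ≡ v → y ≡ u → ¬ IsLoop e →
      Unique (walkEdges s) → (∀ {f} → f ∈ walkEdges s → f ∈ walkEdges p) →
      γ (arc e x y b) ∙ gain s ≈ gain (step e a p) ⁻¹
    against b s refl refl ¬loop uniq s⊆p
      with refl ← trail-in-path (reverseʷ p) s (path-reverseʷ p path) uniq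
                    (∈-walkEdges-reverseʷ⁺ p ∘ s⊆p) =
      A.trans (∙-cong (γ-reverse (arc e u v a) ¬loop) (gain-reverse-path Φ p path)) (⁻¹-∙-comm _ _)

    orient : (x₁ ≡ u × x₂ ≡ v) ⊎ (x₁ ≡ v × x₂ ≡ u) → _
    orient (inj₁ (x≡u , y≡v)) =
      inj₁ (A.trans rotated (along b (q ++ʷ r) x≡u y≡v (AllPairs.tail uniq′) qr⊆p))
    orient (inj₂ (x≡v , y≡u)) with end₁ e ≟ end₂ e
    ... | no ¬loop =
      inj₂ (A.trans rotated (against b (q ++ʷ r) x≡v y≡u ¬loop (AllPairs.tail uniq′) qr⊆p))
    -- For a loop, `u` and `v` coincide, so this traversal is also one along `p`; the reversal rule
    -- does not cover loops.
    ... | yes loop =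
      inj₁ (A.trans rotated (along b (q ++ʷ r) (trans x≡v (sym u≡v)) (trans y≡u u≡v) (AllPairs.tail uniq′) qr⊆p))
      where u≡v = arc-loop {G} {e} a loop

  circuit-balanced : .(a : IsArc e u v) (p : Walk G v u) → IsCircuit e p →
    gain (step e a p) ≈ ε → 𝓑 (walkSubgraph (step e a p))
  circuit-balanced a p circuit null = circuit-cycle a p circuit , λ w simple →
    [ (λ eq → A.trans eq null)
    , (λ eq → A.trans eq (A.trans (⁻¹-cong null) ε⁻¹≈ε)) ]′
    (simple-closed-walk-gain a p circuit w simple)

-- Switching

module _ {G : Graph} {c ℓ} {Γ : Group c ℓ} where
  open Graph G
  open Group Γ hiding (refl; sym; trans)
  private module Γ = Group Γ
  open GroupProperties Γ
  open Gaining
  open SetoidReasoning setoid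

  switch : (Vertex → Carrier) → Gaining G Γ → Gaining G Γ
  switch η Φ .γ a = η (Arc.tail a) ∙ γ Φ a ∙ η (Arc.head a) ⁻¹
  switch η Φ .γ-reverse a@(arc _ u v _) ¬loop = begin
    η v ∙ γ Φ (reverse a) ∙ η u ⁻¹  ≈⟨ ∙-congʳ (∙-congˡ (γ-reverse Φ a ¬loop)) ⟩
    η v ∙ γ Φ a ⁻¹ ∙ η u ⁻¹         ≈⟨ assoc _ _ _ ⟩
    η v ∙ (γ Φ a ⁻¹ ∙ η u ⁻¹)       ≈⟨ ∙-cong (⁻¹-involutive _) (⁻¹-anti-homo-∙ _ _) ⟨
    η v ⁻¹ ⁻¹ ∙ (η u ∙ γ Φ a) ⁻¹    ≈⟨ ⁻¹-anti-homo-∙ _ _ ⟨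
    (η u ∙ γ Φ a ∙ η v ⁻¹) ⁻¹       ∎

  -- Telescoping: at every inner vertex of the walk, the inverse of a value of `η` meets that value.
  gain-switch : ∀ (η : Vertex → Carrier) (Φ : Gaining G Γ) {u v} (w : Walk G u v) →
    gain (switch η Φ) w ≈ η u ∙ gain Φ w ∙ η v ⁻¹
  gain-switch η Φ {u} nil = Γ.sym (Γ.trans (∙-congʳ (identityʳ (η u))) (inverseʳ (η u)))
  gain-switch η Φ {u} {v} (step {v = x} e a w) = begin
    η u ∙ g ∙ η x ⁻¹ ∙ gain (switch η Φ) w          ≈⟨ ∙-congˡ (gain-switch η Φ w) ⟩
    η u ∙ g ∙ η x ⁻¹ ∙ (η x ∙ gain Φ w ∙ η v ⁻¹)    ≈⟨ assoc _ _ _ ⟩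
    η u ∙ g ∙ (η x ⁻¹ ∙ (η x ∙ gain Φ w ∙ η v ⁻¹))  ≈⟨ ∙-congˡ (∙-congˡ (assoc _ _ _)) ⟩
    η u ∙ g ∙ (η x ⁻¹ ∙ (η x ∙ (gain Φ w ∙ η v ⁻¹))) ≈⟨ ∙-congˡ (\\-leftDividesʳ (η x) _) ⟩
    η u ∙ g ∙ (gain Φ w ∙ η v ⁻¹)                   ≈⟨ assoc _ _ _ ⟨
    η u ∙ g ∙ gain Φ w ∙ η v ⁻¹                     ≈⟨ ∙-congʳ (assoc _ _ _) ⟩
    η u ∙ (g ∙ gain Φ w) ∙ η v ⁻¹                   ∎
    where g = γ Φ (arc e u x a)

  module _ (Φ : Gaining G Γ) where

    -- rep chooses a vertex in each class of a partition of the vertices (a union-find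
    -- structure); each class is connected by edges that are null after switching by η.
    record NullForest (es : List Edge) : Set (c ⊔ ℓ) where
      field
        η   : Vertex → Carrier
        rep : Vertex → Vertex

      InClass : Edge → Set ℓ
      InClass e = Null (switch η Φ) e × rep (end₁ e) ≡ rep (end₂ e)

      field
        to-rep : ∀ v → Σ[ w ∈ Walk G v (rep v) ] All InClass (walkEdges w)
        joined : ∀ {e} → e ∈ es → rep (end₁ e) ≡ rep (end₂ e)

    -- Edges are processed one at a time. An edge between two classes merges the class of its second
    -- end into that of its first, and `η` is adjusted on the moved class so that the edge becomes
    -- null.
    nullForest : ∀ es → NullForest es
    nullForest []       = record
      { η = λ _ → ε ; rep = id ; to-rep = λ _ → nil , [] ; joined = λ () }
    nullForest (e ∷ es) with nullForest es
    ... | N with NullForest.rep N (end₁ e) ≟ NullForest.rep N (end₂ e)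
    ...   | yes joined = record
      { η = NullForest.η N ; rep = NullForest.rep N ; to-rep = NullForest.to-rep N
      ; joined = λ { (here refl) → joined ; (there i) → NullForest.joined N i } }
    ...   | no ¬joined = record
      { η = η′ ; rep = rep′ ; to-rep = to-rep′
      ; joined = λ { (here refl) → proj₂ in-class-e ; (there i) → rep-cong (joined i) } }
      where
      open NullForest N
      u v : Vertex
      u = end₁ e
      v = end₂ e
      g : Carrier
      g = γ Φ (arc e u v (ends-isArc {G} e))
      -- The switched gain of `e` so far. Multiplying `η` by `δ` from the left on the class of `v`
      -- turns this gain into `δ ∙ δ ⁻¹`.
      δ : Carrier
      δ = η u ∙ g ∙ η v ⁻¹

      move : ∀ {a} {A : Set a} {x} → Dec (rep x ≡ rep v) → A → A → A
      move (yes _) y n = y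
      move (no _)  y n = n

      rep′ : Vertex → Vertex
      rep′ x = move {x = x} (rep x ≟ rep v) (rep u) (rep x)
      η′ : Vertex → Carrier
      η′ x = move {x = x} (rep x ≟ rep v) (δ ∙ η x) (η x)

      rep-cong : ∀ {x y} → rep x ≡ rep y → rep′ x ≡ rep′ y
      rep-cong {x} {y} eq with rep x ≟ rep v | rep y ≟ rep v
      ... | yes _ | yes _ = refl
      ... | no _  | no _  = eq
      ... | yes p | no ¬q = contradiction (trans (sym eq) p) ¬q
      ... | no ¬p | yes q = contradiction (trans eq q) ¬p

      -- Both ends lie in one class, so the switched gain is either left alone or conjugated by `δ`;
      -- it stays trivial.
      null-conj : ∀ {x y h} → rep x ≡ rep y → η x ∙ h ∙ η y ⁻¹ ≈ ε → η′ x ∙ h ∙ η′ y ⁻¹ ≈ ε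
      null-conj {x} {y} {h} eq null with rep x ≟ rep v | rep y ≟ rep v
      ... | no _  | no _  = null
      ... | yes p | no ¬q = contradiction (trans (sym eq) p) ¬q
      ... | no ¬p | yes q = contradiction (trans eq q) ¬p
      ... | yes _ | yes _ = begin
        δ ∙ η x ∙ h ∙ (δ ∙ η y) ⁻¹      ≈⟨ ∙-congˡ (⁻¹-anti-homo-∙ _ _) ⟩
        δ ∙ η x ∙ h ∙ (η y ⁻¹ ∙ δ ⁻¹)   ≈⟨ assoc _ _ _ ⟨
        δ ∙ η x ∙ h ∙ η y ⁻¹ ∙ δ ⁻¹     ≈⟨ ∙-congʳ (∙-congʳ (assoc _ _ _)) ⟩
        δ ∙ (η x ∙ h) ∙ η y ⁻¹ ∙ δ ⁻¹   ≈⟨ ∙-congʳ (assoc _ _ _) ⟩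
        δ ∙ (η x ∙ h ∙ η y ⁻¹) ∙ δ ⁻¹   ≈⟨ ∙-congʳ (∙-congˡ null) ⟩
        δ ∙ ε ∙ δ ⁻¹                    ≈⟨ ∙-congʳ (identityʳ δ) ⟩
        δ ∙ δ ⁻¹                        ≈⟨ inverseʳ δ ⟩
        ε                               ∎

      InClass′ : Edge → Set ℓ
      InClass′ f = Null (switch η′ Φ) f × rep′ (end₁ f) ≡ rep′ (end₂ f)

      preserve : ∀ {f} → InClass f → InClass′ f
      preserve (null , eq) = null-conj eq null , rep-cong eq

      in-class-e : InClass′ e
      in-class-e with rep u ≟ rep v | rep v ≟ rep v
      ... | yes p | _     = contradiction p ¬joined
      ... | no _  | no ¬q = contradiction refl ¬q
      ... | no _  | yes _ = (begin
        η u ∙ g ∙ (η u ∙ g ∙ η v ⁻¹ ∙ η v) ⁻¹ ≈⟨ ∙-congˡ (⁻¹-cong (//-rightDividesˡ (η v) _)) ⟩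
        η u ∙ g ∙ (η u ∙ g) ⁻¹                ≈⟨ inverseʳ _ ⟩
        ε                                     ∎) , refl

      to-rep′ : ∀ x → Σ[ w ∈ Walk G x (rep′ x) ] All InClass′ (walkEdges w)
      to-rep′ x with rep x ≟ rep v | to-rep x
      ... | no _  | w , ws = w , All.map preserve ws
      ... | yes p | w , ws with subst (λ y → Σ[ w ∈ Walk G x y ] All InClass (walkEdges w)) p (w , ws)
      ...   | w′ , ws′ =
        -- From `x` to its old representative, back out to `v`, across `e` to `u`, and on to the new
        -- representative.
        w′ ++ʷ reverseʷ (proj₁ (to-rep v)) ++ʷ step e (isArc-sym {e} (ends-isArc {G} e)) (proj₁ (to-rep u)) ,
        all-++ʷ w′ _ (All.map preserve ws′)
          (all-++ʷ (reverseʷ (proj₁ (to-rep v))) _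
            (all-reverseʷ (proj₁ (to-rep v)) (All.map preserve (proj₂ (to-rep v))))
            (in-class-e ∷ All.map preserve (proj₂ (to-rep u))))

    -- Once all edges are processed, the two ends of an edge share a representative, and their null
    -- walks to it are joined there.
    switch-null-connected : Σ[ η ∈ (Vertex → Carrier) ] ∀ e →
      Σ[ w ∈ Walk G (end₁ e) (end₂ e) ] All (Null (switch η Φ)) (walkEdges w)
    switch-null-connected = η , λ e →
      let w₁ , null₁ = subst (λ y → Σ[ w ∈ Walk G (end₁ e) y ] All InClass (walkEdges w))
                         (joined (∈-allFin e)) (to-rep (end₁ e))
          w₂ , null₂ = to-rep (end₂ e)
      in w₁ ++ʷ reverseʷ w₂ ,
         All.map proj₁ (all-++ʷ w₁ _ null₁ (all-reverseʷ w₂ null₂))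
      where open NullForest (nullForest (allFin #E))

module _ {G : Graph} {c ℓ} (A : AbelianGroup c ℓ) where
  open AbelianGroup A hiding (refl; sym; trans)
  open import Algebra.Properties.AbelianGroup A using (xyx⁻¹≈y)
  open Gaining

  gain-switch-closed : ∀ η (Φ : Gaining G group) {u} (w : Walk G u u) →
    gain (switch η Φ) w ≈ gain Φ w
  gain-switch-closed η Φ w = AbelianGroup.trans A (gain-switch η Φ w) (xyx⁻¹≈y _ _)

-- Paths between disjoint vertex sets

module _ {G : Graph} where
  open Graph G

  private
    variable
      u v : Vertex

  record Connection {p q r} (P : Pred Edge p) (X : Pred Vertex q) (Y : Pred Vertex r)
      : Set (p ⊔ q ⊔ r) where
    constructor connection
    field
      {x y}  : Vertex
      walk   : Walk G x y
      isPath : IsPath walk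
      edges  : All P (walkEdges walk)
      x∈X    : X x
      y∈Y    : Y y
      only-x : ∀ {z} → z ∈ walkVertices walk → X z → z ≡ x
      only-y : ∀ {z} → z ∈ walkVertices walk → Y z → z ≡ y

  module _ {p r} {P : Pred Edge p} {Y : Pred Vertex r} (Y? : Decidable Y) where

    -- The walk is stopped at its first vertex in `Y` and its loops are erased from the back: if `u`
    -- already lies on the path found for the tail, only the part from `u` on is kept.
    path-into : (w : Walk G u v) → All P (walkEdges w) → Y v → Connection P (_≡ u) Y
    path-into {u} nil ps Yv = connection nil ([] ∷ []) [] refl Yv (λ _ → id) λ { (here eq) _ → eq }
    path-into {u} (step e a w) (Pe ∷ ps) Yv with Y? u | path-into w ps Yv
    ... | yes Yu | _ = connection nil ([] ∷ []) [] refl Yu (λ _ → id) λ { (here eq) _ → eq }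
    ... | no ¬Yu | connection r path rs refl Yy _ only with member? _≟_ u (walkVertices r)
    ...   | no u∉ = connection (step e a r) (path-step {a = a} {w = r} u∉ path) (Pe ∷ rs) refl Yy (λ _ → id)
      λ { (here refl) Yu → contradiction Yu ¬Yu ; (there i) → only i }
    ...   | yes u∈ with split-vertex r u∈
    ...     | r₁ , r₂ , refl = connection r₂ (path-++ʷ⁻ʳ r₁ r₂ path)
      (All.tabulate λ i → All.lookup rs (∈-walkEdges-++ʷ⁺ʳ r₁ r₂ i)) refl Yy (λ _ → id)
      λ i → only (∈-walkVertices-++ʷ⁺ʳ r₁ r₂ i)

    module _ {q} {X : Pred Vertex q} (X? : Decidable X) where

      -- Everything before the last vertex in `X` is cut off; the suffix still meets `Y` only at its
      -- end.
      path-out-of : (w : Walk G u v) → IsPath w → All P (walkEdges w) →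
        Any X (walkVertices w) → Y v →
        (∀ {z} → z ∈ walkVertices w → Y z → z ≡ v) → Connection P X Y
      path-out-of nil path ps (here Xu) Yv only =
        connection nil path ps Xu Yv (λ { (here eq) _ → eq }) only
      path-out-of (step e a w) path@(_ ∷ path′) (Pe ∷ ps) some Yv only with Any.any? X? (walkVertices w) | some
      ... | yes some′ | _ = path-out-of w path′ ps some′ Yv (only ∘ there)
      ... | no none | there some′ = contradiction some′ none
      ... | no none | here Xu = connection (step e a w) path (Pe ∷ ps) Xu Yv
        (λ { (here eq) _ → eq ; (there i) Xz → contradiction (Any.map (λ { refl → Xz }) i) none }) only

      connect : (w : Walk G u v) → All P (walkEdges w) → X u → Y v → Connection P X Y
      connect w ps Xu Yv with path-into w ps Yv
      ... | connection r path rs refl Yy _ only =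
        path-out-of r path rs (Any.map (λ { refl → Xu }) (first∈ r)) Yy only

-- Lifting along partial homomorphisms

module _ {G : Graph} {c ℓ} (A : AbelianGroup c ℓ) (Ψ : Gaining G (AbelianGroup.group A)) where
  open Graph G
  open AbelianGroup A hiding (refl; sym; trans)
  open Gaining Ψ
  open SetoidReasoning setoid
  open import Algebra.Solver.CommutativeMonoid commutativeMonoid

  private
    variable
      u v x y : Vertex
      e₁ e₂ : Edge

  gain-rotate : .(a : IsArc e₁ u v) (p : Walk G v x) .(b : IsArc e₂ x y) (q : Walk G y u) →
    gain (step e₁ a (p ++ʷ step e₂ b q)) ≈ gain (step e₂ b (q ++ʷ step e₁ a p))
  gain-rotate a p b q = begin
    _ ∙ gain (p ++ʷ step _ b q)  ≈⟨ ∙-congˡ (gain-++ʷ Ψ p (step _ b q)) ⟩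
    _ ∙ (gain p ∙ (_ ∙ gain q))
      ≈⟨ prove 4 (var (# 0) ⊕ var (# 1) ⊕ var (# 2) ⊕ var (# 3))
                 (var (# 2) ⊕ var (# 3) ⊕ var (# 0) ⊕ var (# 1)) (_ ∷ gain p ∷ _ ∷ gain q ∷ []) ⟩
    _ ∙ (gain q ∙ (_ ∙ gain p))  ≈⟨ ∙-congˡ (gain-++ʷ Ψ q (step _ a p)) ⟨
    _ ∙ gain (q ++ʷ step _ a p)  ∎

  -- The chord `r`, with return walk `r′`, cuts the closed walk on the right into the two on the
  -- left. Its own contributions vanish, and commutativity rearranges the rest.
  gain-theta : .(a₁ : IsArc e₁ u v) .(a₂ : IsArc e₂ x y) → ∀ {x′ y′}
    (p : Walk G v x′) (p′ : Walk G x′ x) (q : Walk G y y′) (q′ : Walk G y′ u)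
    (r : Walk G x′ y′) (r′ : Walk G y′ x′) → gain r ≈ ε → gain r′ ≈ ε →
    gain (step e₁ a₁ (p ++ʷ r ++ʷ q′)) ∙ gain (step e₂ a₂ (q ++ʷ r′ ++ʷ p′)) ≈
    gain (step e₁ a₁ ((p ++ʷ p′) ++ʷ step e₂ a₂ (q ++ʷ q′)))
  gain-theta {e₁} {u} {v} {e₂} {x} {y} a₁ a₂ p p′ q q′ r r′ null null′ = begin
    g₁ ∙ gain (p ++ʷ r ++ʷ q′) ∙ (g₂ ∙ gain (q ++ʷ r′ ++ʷ p′))
      ≈⟨ ∙-cong (∙-congˡ (skip p r q′ null)) (∙-congˡ (skip q r′ p′ null′)) ⟩
    g₁ ∙ (gain p ∙ gain q′) ∙ (g₂ ∙ (gain q ∙ gain p′))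
      ≈⟨ prove 6 ((var (# 0) ⊕ var (# 1) ⊕ var (# 4)) ⊕ (var (# 5) ⊕ var (# 3) ⊕ var (# 2)))
                 (var (# 0) ⊕ (var (# 1) ⊕ var (# 2)) ⊕ var (# 5) ⊕ var (# 3) ⊕ var (# 4))
                 (g₁ ∷ gain p ∷ gain p′ ∷ gain q ∷ gain q′ ∷ g₂ ∷ []) ⟩
    g₁ ∙ (gain p ∙ gain p′ ∙ (g₂ ∙ (gain q ∙ gain q′)))
      ≈⟨ ∙-congˡ (∙-cong (gain-++ʷ Ψ p p′) (∙-congˡ (gain-++ʷ Ψ q q′))) ⟨
    g₁ ∙ (gain (p ++ʷ p′) ∙ (g₂ ∙ gain (q ++ʷ q′)))
      ≈⟨ ∙-congˡ (gain-++ʷ Ψ (p ++ʷ p′) (step e₂ a₂ (q ++ʷ q′))) ⟨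
    g₁ ∙ gain ((p ++ʷ p′) ++ʷ step e₂ a₂ (q ++ʷ q′)) ∎
    where
    g₁ = γ (arc e₁ u v a₁)
    g₂ = γ (arc e₂ x y a₂)
    skip : ∀ {u v x y} (p : Walk G u v) (r : Walk G v x) (q : Walk G x y) → gain r ≈ ε →
      gain (p ++ʷ r ++ʷ q) ≈ gain p ∙ gain q
    skip p r q null = begin
      gain (p ++ʷ r ++ʷ q)       ≈⟨ gain-++ʷ Ψ p (r ++ʷ q) ⟩
      gain p ∙ gain (r ++ʷ q)    ≈⟨ ∙-congˡ (gain-++ʷ Ψ r q) ⟩
      gain p ∙ (gain r ∙ gain q) ≈⟨ ∙-congˡ (∙-congʳ null) ⟩
      gain p ∙ (ε ∙ gain q)      ≈⟨ ∙-congˡ (identityˡ _) ⟩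
      gain p ∙ gain q            ∎

-- Additivity is asked only where both summands and the sum lie in `S`. With the gains of circuits
-- in `S`, this is the situation in a theta subgraph.
record IsPartialHomomorphism {c ℓ c′ ℓ′ s} (A : Group c ℓ) (K : Group c′ ℓ′)
    (S : Pred (Group.Carrier A) s) (f : Group.Carrier A → Group.Carrier K)
    : Set (c ⊔ ℓ ⊔ ℓ′ ⊔ s) where
  private
    module A = Group A
    module K = Group K
  field
    S-resp  : ∀ {x y} → x A.≈ y → S x → S y
    f-cong  : ∀ {x y} → x A.≈ y → f x K.≈ f y
    f-ε     : f A.ε K.≈ K.ε
    f-⁻¹    : ∀ x → f (x A.⁻¹) K.≈ f x K.⁻¹
    f-∙     : ∀ {x y} → S x → S y → S (x A.∙ y) → f (x A.∙ y) K.≈ f x K.∙ f y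

module _ {G : Graph} {c ℓ c′ ℓ′ s} {A : AbelianGroup c ℓ} {K : AbelianGroup c′ ℓ′}
  {S : Pred (AbelianGroup.Carrier A) s} {f : AbelianGroup.Carrier A → AbelianGroup.Carrier K}
  (_≟A_ : Decidable₂ (AbelianGroup._≈_ A))
  (f-hom : IsPartialHomomorphism (AbelianGroup.group A) (AbelianGroup.group K) S f)
  where
  open Graph G
  open IsPartialHomomorphism f-hom
  open Gaining
  private
    module A = AbelianGroup A
    module K = AbelianGroup K

  image : Gaining G A.group → Gaining G K.group
  image = mapGaining f f-cong f-⁻¹

  -- Induction on the number of non-null edges of a circuit

  module _ (Φ : Gaining G A.group)
    (null-walk : ∀ e → Σ[ w ∈ Walk G (end₁ e) (end₂ e) ] All (Null Φ) (walkEdges w))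
    (S-circuit : ∀ {e u v} .(a : IsArc e u v) (p : Walk G v u) → IsCircuit e p →
                 S (gain Φ (step e a p)))
    where

    private
      variable
        u v x : Vertex

    null? : Decidable (Null Φ)
    null? e = _ ≟A _

    null-image : ∀ {e} → Null Φ e → Null (image Φ) e
    null-image null = K.trans (f-cong null) f-ε

    nonNulls : Walk G u v → ℕ
    nonNulls w = length (filter (¬? ∘ null?) (walkEdges w))

    nonNulls-++ʷ : (p : Walk G u v) (q : Walk G v x) →
      nonNulls (p ++ʷ q) ≡ nonNulls p + nonNulls q
    nonNulls-++ʷ p q rewrite walkEdges-++ʷ p q | filter-++ (¬? ∘ null?) (walkEdges p) (walkEdges q) =
      length-++ (filter (¬? ∘ null?) (walkEdges p))

    nonNulls-null : (w : Walk G u v) → All (Null Φ) (walkEdges w) → nonNulls w ≡ 0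
    nonNulls-null w nulls = cong length (filter-none (¬? ∘ null?) (All.map (λ null ¬null → ¬null null) nulls))

    nonNulls-step-null : ∀ {e} .(a : IsArc e u v) (w : Walk G v x) → Null Φ e →
      nonNulls (step e a w) ≡ nonNulls w
    nonNulls-step-null a w null = cong length (filter-reject (¬? ∘ null?) (λ ¬null → ¬null null))

    nonNulls-split : ∀ {e u v x y} (p : Walk G u v) .(a : IsArc e v x) (q : Walk G x y) →
      ¬ Null Φ e → nonNulls (p ++ʷ step e a q) ≡ suc (nonNulls p + nonNulls q)
    nonNulls-split {e} p a q ¬null = begin
      nonNulls (p ++ʷ step e a q)        ≡⟨ nonNulls-++ʷ p (step e a q) ⟩
      nonNulls p + nonNulls (step e a q) ≡⟨ cong (nonNulls p +_) (cong length (filter-accept (¬? ∘ null?) ¬null)) ⟩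
      nonNulls p + suc (nonNulls q)      ≡⟨ ℕ.+-suc _ _ ⟩
      suc (nonNulls p + nonNulls q)      ∎
      where open ≡-Reasoning

    arc-null-walk : ∀ {e} → .(IsArc e u v) → Σ[ w ∈ Walk G u v ] All (Null Φ) (walkEdges w)
    arc-null-walk {e = e} a with arc-ends {G} {e} a
    ... | inj₁ (refl , refl) = null-walk e
    ... | inj₂ (refl , refl) = let w , nulls = null-walk e in reverseʷ w , all-reverseʷ w nulls

    null∌ : ∀ {e} (w : Walk G u v) → All (Null Φ) (walkEdges w) → ¬ Null Φ e → e ∉ walkEdges w
    null∌ w nulls ¬null i = ¬null (All.lookup nulls i)

    ImageGain : ∀ {u} → Walk G u u → Set ℓ′
    ImageGain w = gain (image Φ) w K.≈ f (gain Φ w)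

    -- The count leaves out the closing edge `e`, which is what lets a mere rotation of the circuit
    -- lower it.
    ImageGainUpTo : ℕ → Set ℓ′
    ImageGainUpTo n = ∀ {e u v} .(a : IsArc e u v) (p : Walk G v u) → IsCircuit e p →
      nonNulls p ≤ n → ImageGain (step e a p)

    module _ {n} (ih : ImageGainUpTo n) {e₁ e₂ u v x y}
      .(a : IsArc e₁ u v) .(b : IsArc e₂ x y) (p : Walk G v x) (q : Walk G y u)
      (circuit : IsCircuit e₁ (p ++ʷ step e₂ b q)) (¬null₂ : ¬ Null Φ e₂)
      (bound : nonNulls p + nonNulls q ≤ n)
      where

      private
        pq : Walk G v u
        pq = p ++ʷ step e₂ b q

        p-path : IsPath p
        p-path = path-++ʷ⁻ˡ p (step e₂ b q) (proj₁ circuit)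

        e₂q-path : IsPath (step e₂ b q)
        e₂q-path = path-++ʷ⁻ʳ p (step e₂ b q) (proj₁ circuit)

        q-path : IsPath q
        q-path = AllPairs.tail e₂q-path

        x∉q : x ∉ walkVertices q
        x∉q = All¬⇒¬Any (AllPairs.head e₂q-path)

        disjoint : ∀ {z} → z ∈ walkVertices p → z ∉ walkVertices q
        disjoint i j with refl ← path-++ʷ⁻-meet p (step e₂ b q) (proj₁ circuit) i (there j) = x∉q j

        e₁∉p : e₁ ∉ walkEdges p
        e₁∉p = proj₂ circuit ∘ ∈-walkEdges-++ʷ⁺ˡ p (step e₂ b q)

        e₁∉q : e₁ ∉ walkEdges q
        e₁∉q = proj₂ circuit ∘ ∈-walkEdges-++ʷ⁺ʳ p (step e₂ b q) ∘ there

        e₂∉p : e₂ ∉ walkEdges p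
        e₂∉p i = disjoint (incident∈ p i (arc-head-incident {G} {e₂} b)) (first∈ q)

        e₂∉q : e₂ ∉ walkEdges q
        e₂∉q i = x∉q (incident∈ q i (arc-tail-incident {G} {e₂} b))

      -- Starting the same closed walk at `e₂` puts the null edge `e₁` into the counted part and
      -- takes the non-null edge `e₂` out of it.
      image-gain-rotate : Null Φ e₁ → ImageGain (step e₁ a pq)
      image-gain-rotate null₁ = K.trans (gain-rotate K (image Φ) a p b q)
        (K.trans (ih b (q ++ʷ step e₁ a p) (path′ , e₂∉) bound′)
          (f-cong (A.sym (gain-rotate A Φ a p b q))))
        where
        path′ : IsPath (q ++ʷ step e₁ a p)
        path′ = path-++ʷ⁺ q (step e₁ a p) q-path
          (path-step {a = a} {w = p} (λ i → disjoint i (last∈ q)) p-path)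
          λ { _ (here eq) → eq ; i (there j) → contradiction i (disjoint j) }

        e₂∉ : e₂ ∉ walkEdges (q ++ʷ step e₁ a p)
        e₂∉ i with ∈-walkEdges-++ʷ⁻ q (step e₁ a p) i
        ... | inj₁ j           = e₂∉q j
        ... | inj₂ (here refl) = ¬null₂ null₁
        ... | inj₂ (there j)   = e₂∉p j

        bound′ : nonNulls (q ++ʷ step e₁ a p) ≤ n
        bound′ = begin
          nonNulls (q ++ʷ step e₁ a p)         ≡⟨ nonNulls-++ʷ q (step e₁ a p) ⟩
          nonNulls q + nonNulls (step e₁ a p)  ≡⟨ cong (nonNulls q +_) (nonNulls-step-null a p null₁) ⟩
          nonNulls q + nonNulls p              ≡⟨ ℕ.+-comm (nonNulls q) _ ⟩
          nonNulls p + nonNulls q              ≤⟨ bound ⟩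
          n                                    ∎
          where open ℕ.≤-Reasoning

      -- A null walk joins the ends of `e₂`, so it contains a path `r` that meets `p` only in its
      -- first vertex and `q` only in its last. Being null, `r` avoids `e₁` and `e₂`; it thus forms
      -- a theta with the circuit, and each of the two circuits through `r` contains just one of
      -- these edges.
      image-gain-theta : ¬ Null Φ e₁ → ImageGain (step e₁ a pq)
      image-gain-theta ¬null₁ with arc-null-walk b
      ... | w , nulls
        with connect (λ z → member? _≟_ z (walkVertices q)) (λ z → member? _≟_ z (walkVertices p))
               w nulls (last∈ p) (first∈ q)
      ... | connection r r-path r-null x∈p y∈q only-x only-y
        with split-vertex p x∈p | split-vertex q y∈q
      ... | p₁ , p₂ , p≡ | q₁ , q₂ , q≡ = theta p₁ p₂ q₁ q₂ p≡ q≡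
        where
        theta : ∀ p₁ p₂ q₁ q₂ → p ≡ p₁ ++ʷ p₂ → q ≡ q₁ ++ʷ q₂ → ImageGain (step e₁ a pq)
        theta p₁ p₂ q₁ q₂ refl refl = let open SetoidReasoning K.setoid in begin
          gain (image Φ) (step e₁ a pq)
            ≈⟨ gain-theta K (image Φ) a b p₁ p₂ q₁ q₂ r r⁻ (null-gain (image Φ) r (All.map null-image r-null))
                 (null-gain (image Φ) r⁻ (All.map null-image r⁻-null)) ⟨
          gain (image Φ) w₁ K.∙ gain (image Φ) w₂
            ≈⟨ K.∙-cong (ih a c₁ circuit₁ bound₁) (ih b c₂ circuit₂ bound₂) ⟩
          f (gain Φ w₁) K.∙ f (gain Φ w₂)
            -- The summands and the sum are gains of the three circuits of the theta, so all of them
            -- lie in `S`.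
            ≈⟨ f-∙ (S-circuit a c₁ circuit₁) (S-circuit b c₂ circuit₂)
                   (S-resp (A.sym Φ-theta) (S-circuit a pq circuit)) ⟨
          f (gain Φ w₁ A.∙ gain Φ w₂)
            ≈⟨ f-cong Φ-theta ⟩
          f (gain Φ (step e₁ a pq)) ∎
          where
          r⁻ = reverseʷ r
          r⁻-null = all-reverseʷ r r-null
          c₁ = p₁ ++ʷ r ++ʷ q₂
          c₂ = q₁ ++ʷ r⁻ ++ʷ p₂
          w₁ = step e₁ a c₁
          w₂ = step e₂ b c₂

          Φ-theta = gain-theta A Φ a b p₁ p₂ q₁ q₂ r r⁻ (null-gain Φ r r-null) (null-gain Φ r⁻ r⁻-null)

          circuit₁ : IsCircuit e₁ c₁
          circuit₁ =
            path-++ʷ⁺ p₁ (r ++ʷ q₂) (path-++ʷ⁻ˡ p₁ p₂ p-path)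
              (path-++ʷ⁺ r q₂ r-path (path-++ʷ⁻ʳ q₁ q₂ q-path)
                λ i j → only-y i (∈-walkVertices-++ʷ⁺ʳ q₁ q₂ j))
              (λ i j → let i′ = ∈-walkVertices-++ʷ⁺ˡ p₁ p₂ i in
                [ (λ k → only-x k i′)
                , (λ k → contradiction (∈-walkVertices-++ʷ⁺ʳ q₁ q₂ k) (disjoint i′)) ]′
                (∈-walkVertices-++ʷ⁻ r q₂ j)) ,
            λ i → [ e₁∉p ∘ ∈-walkEdges-++ʷ⁺ˡ p₁ p₂
                  , [ null∌ r r-null ¬null₁ , e₁∉q ∘ ∈-walkEdges-++ʷ⁺ʳ q₁ q₂ ]′ ∘ ∈-walkEdges-++ʷ⁻ r q₂ ]′
                  (∈-walkEdges-++ʷ⁻ p₁ (r ++ʷ q₂) i)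

          circuit₂ : IsCircuit e₂ c₂
          circuit₂ =
            path-++ʷ⁺ q₁ (r⁻ ++ʷ p₂) (path-++ʷ⁻ˡ q₁ q₂ q-path)
              (path-++ʷ⁺ r⁻ p₂ (path-reverseʷ r r-path) (path-++ʷ⁻ʳ p₁ p₂ p-path)
                λ i j → only-x (∈-walkVertices-reverseʷ⁻ r i) (∈-walkVertices-++ʷ⁺ʳ p₁ p₂ j))
              (λ i j → let i′ = ∈-walkVertices-++ʷ⁺ˡ q₁ q₂ i in
                [ (λ k → only-y (∈-walkVertices-reverseʷ⁻ r k) i′)
                , (λ k → contradiction i′ (disjoint (∈-walkVertices-++ʷ⁺ʳ p₁ p₂ k))) ]′
                (∈-walkVertices-++ʷ⁻ r⁻ p₂ j)) ,
            λ i → [ e₂∉q ∘ ∈-walkEdges-++ʷ⁺ˡ q₁ q₂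
                  , [ null∌ r⁻ r⁻-null ¬null₂ , e₂∉p ∘ ∈-walkEdges-++ʷ⁺ʳ p₁ p₂ ]′ ∘ ∈-walkEdges-++ʷ⁻ r⁻ p₂ ]′
                  (∈-walkEdges-++ʷ⁻ q₁ (r⁻ ++ʷ p₂) i)

          nonNulls-through : ∀ {u v x y} (p : Walk G u v) (r : Walk G v x) (q : Walk G x y) →
            All (Null Φ) (walkEdges r) → nonNulls (p ++ʷ r ++ʷ q) ≡ nonNulls p + nonNulls q
          nonNulls-through p r q nulls =
            trans (nonNulls-++ʷ p (r ++ʷ q)) (cong (nonNulls p +_)
              (trans (nonNulls-++ʷ r q) (cong (_+ nonNulls q) (nonNulls-null r nulls))))

          bound₁ : nonNulls c₁ ≤ n
          bound₁ = begin
            nonNulls c₁                              ≡⟨ nonNulls-through p₁ r q₂ r-null ⟩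
            nonNulls p₁ + nonNulls q₂                ≤⟨ ℕ.+-mono-≤ (ℕ.m≤m+n (nonNulls p₁) (nonNulls p₂)) (ℕ.m≤n+m (nonNulls q₂) (nonNulls q₁)) ⟩
            (nonNulls p₁ + nonNulls p₂) + (nonNulls q₁ + nonNulls q₂)
                                                     ≡⟨ cong₂ _+_ (nonNulls-++ʷ p₁ p₂) (nonNulls-++ʷ q₁ q₂) ⟨
            nonNulls (p₁ ++ʷ p₂) + nonNulls (q₁ ++ʷ q₂) ≤⟨ bound ⟩
            n                                        ∎
            where open ℕ.≤-Reasoning

          bound₂ : nonNulls c₂ ≤ n
          bound₂ = begin
            nonNulls c₂                              ≡⟨ nonNulls-through q₁ r⁻ p₂ r⁻-null ⟩
            nonNulls q₁ + nonNulls p₂                ≡⟨ ℕ.+-comm (nonNulls q₁) _ ⟩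
            nonNulls p₂ + nonNulls q₁                ≤⟨ ℕ.+-mono-≤ (ℕ.m≤n+m (nonNulls p₂) (nonNulls p₁)) (ℕ.m≤m+n (nonNulls q₁) (nonNulls q₂)) ⟩
            (nonNulls p₁ + nonNulls p₂) + (nonNulls q₁ + nonNulls q₂)
                                                     ≡⟨ cong₂ _+_ (nonNulls-++ʷ p₁ p₂) (nonNulls-++ʷ q₁ q₂) ⟨
            nonNulls (p₁ ++ʷ p₂) + nonNulls (q₁ ++ʷ q₂) ≤⟨ bound ⟩
            n                                        ∎
            where open ℕ.≤-Reasoning

    -- If `p` is null, the gain is that of the edge `e`, to which `f` was applied directly.
    -- Otherwise `p` has a non-null edge, and the circuit is rotated or split by a theta according
    -- to whether `e` is null.
    image-gain-step : ∀ {n} → (∀ {m} → m < n → ImageGainUpTo m) → ImageGainUpTo n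
    image-gain-step {n} ih {e} a p circuit bound with All.all? null? (walkEdges p)
    ... | yes nulls = begin
      f (γ Φ _) K.∙ gain (image Φ) p
        ≈⟨ K.∙-congˡ (null-gain (image Φ) p (All.map null-image nulls)) ⟩
      f (γ Φ _) K.∙ K.ε
        ≈⟨ K.identityʳ _ ⟩
      f (γ Φ _)
        ≈⟨ f-cong (A.trans (A.∙-congˡ (null-gain Φ p nulls)) (A.identityʳ _)) ⟨
      f (γ Φ _ A.∙ gain Φ p) ∎
      where open SetoidReasoning K.setoid
    ... | no ¬nulls with find (¬All⇒Any¬ null? _ ¬nulls)
    ...   | f₂ , f₂∈p , ¬null₂ with split-edge p f₂∈p
    ...     | edgeSplit p₁ b p₂ refl with null? e
    ...       | yes null₁ = image-gain-rotate (ih fewer) a b p₁ p₂ circuit ¬null₂ ℕ.≤-refl null₁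
      where
      fewer : nonNulls p₁ + nonNulls p₂ < n
      fewer = subst (_≤ n) (nonNulls-split p₁ b p₂ ¬null₂) bound
    ...       | no ¬null₁ = image-gain-theta (ih fewer) a b p₁ p₂ circuit ¬null₂ ℕ.≤-refl ¬null₁
      where
      fewer : nonNulls p₁ + nonNulls p₂ < n
      fewer = subst (_≤ n) (nonNulls-split p₁ b p₂ ¬null₂) bound

    image-gain : ∀ {e u v} .(a : IsArc e u v) (p : Walk G v u) → IsCircuit e p → ImageGain (step e a p)
    image-gain a p circuit =
      <-rec ImageGainUpTo (λ _ ih → image-gain-step ih) (nonNulls p) a p circuit ℕ.≤-refl

-- Transfer along homomorphisms

module _ {c ℓ c′ ℓ′ b} {Γ : Group c ℓ} {Δ : Group c′ ℓ′} (Ω : BiasedGraph b) where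
  private
    module Γ = Group Γ
    module Δ = Group Δ
  open BiasedGraph Ω
  open Gaining

  -- A homomorphism keeps trivial gains trivial. The converse is asked only at gains of cycles,
  -- which lets the integers be mapped to the powers of an element of finite order.
  gainable-map : (f : Γ.Carrier → Δ.Carrier) → (∀ {x y} → x Γ.≈ y → f x Δ.≈ f y) →
    (∀ x y → f (x Γ.∙ y) Δ.≈ f x Δ.∙ f y) → ((Φ , _) : Gainable Γ Ω) →
    (∀ C → IsCycle C → ∀ {u} (w : Walk graph u u) → IsSimpleClosedWalk C w →
      f (gain Φ w) Δ.≈ Δ.ε → gain Φ w Γ.≈ Γ.ε) →
    Gainable Δ Ω
  gainable-map f f-cong f-∙ (Φ , ⊆𝓑 , 𝓑⊆) kernel = Ψ ,
    (λ {C} C∈ → let cyc , null = ⊆𝓑 {C} C∈ in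
      cyc , λ w simple → Δ.trans (gain-map w) (Δ.trans (f-cong (null w simple)) f-ε)) ,
    (λ { {C} (cyc , null) → 𝓑⊆ {C} (cyc , λ w simple →
      kernel C cyc w simple (Δ.trans (Δ.sym (gain-map w)) (null w simple))) })
    where
    open GroupProperties Δ

    f-ε : f Γ.ε Δ.≈ Δ.ε
    f-ε = identityˡ-unique (f Γ.ε) (f Γ.ε)
      (Δ.trans (Δ.sym (f-∙ Γ.ε Γ.ε)) (f-cong (Γ.identityˡ Γ.ε)))

    f-⁻¹ : ∀ x → f (x Γ.⁻¹) Δ.≈ f x Δ.⁻¹
    f-⁻¹ x = inverseˡ-unique (f (x Γ.⁻¹)) (f x)
      (Δ.trans (Δ.sym (f-∙ (x Γ.⁻¹) x)) (Δ.trans (f-cong (Γ.inverseˡ x)) f-ε))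

    Ψ : Gaining graph Δ
    Ψ = mapGaining f f-cong f-⁻¹ Φ

    gain-map : ∀ {u v} (w : Walk graph u v) → gain Ψ w Δ.≈ f (gain Φ w)
    gain-map nil          = Δ.sym f-ε
    gain-map (step e a w) = Δ.trans (Δ.∙-congˡ (gain-map w)) (Δ.sym (f-∙ _ _))

-- `ℤ₃` and `ℤ₂²` live at the lowest universe level, while the theorem quantifies over groups at
-- given levels; lifted copies can be substituted there.
liftGroup : ∀ {a ℓ} c ℓ′ → Group a ℓ → Group (a ⊔ c) (ℓ ⊔ ℓ′)
liftGroup c ℓ′ Γ = record
  { Carrier = Lift c Carrier
  ; _≈_     = λ x y → Lift ℓ′ (lower x ≈ lower y)
  ; _∙_     = λ x y → lift (lower x ∙ lower y)
  ; ε       = lift ε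
  ; _⁻¹     = λ x → lift (lower x ⁻¹)
  ; isGroup = record
    { isMonoid = record
      { isSemigroup = record
        { isMagma = record
          { isEquivalence = record
            { refl  = lift Γ.refl
            ; sym   = λ p → lift (Γ.sym (lower p))
            ; trans = λ p q → lift (Γ.trans (lower p) (lower q))
            }
          ; ∙-cong = λ p q → lift (∙-cong (lower p) (lower q))
          }
        ; assoc = λ x y z → lift (assoc (lower x) (lower y) (lower z))
        }
      ; identity = (λ x → lift (identityˡ (lower x))) , (λ x → lift (identityʳ (lower x)))
      }
    ; inverse = (λ x → lift (inverseˡ (lower x))) , (λ x → lift (inverseʳ (lower x)))
    ; ⁻¹-cong = λ p → lift (⁻¹-cong (lower p))
    }
  }
  where
  open Group Γ hiding (refl; sym; trans)
  module Γ = Group Γ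

gainable-lower : ∀ {a ℓ c ℓ′ b} (Γ : Group a ℓ) (Ω : BiasedGraph b) →
  Gainable (liftGroup c ℓ′ Γ) Ω → Gainable Γ Ω
gainable-lower Γ Ω g = gainable-map Ω lower lower (λ _ _ → Group.refl Γ) g λ _ _ _ _ → lift

ℤ₃-size : HasSizeAtLeast 3 ℤ₃
ℤ₃-size = record { to = id ; cong = id ; injective = id }

ℤ₂²-size : HasSizeAtLeast 3 ℤ₂²
ℤ₂²-size = record { to = to ; cong = λ { refl → refl , refl } ; injective = injective }
  where
  to : Fin 3 → Group.Carrier ℤ₂²
  to zero             = # 0 , # 0
  to (suc zero)       = # 1 , # 0
  to (suc (suc zero)) = # 0 , # 1

  injective : ∀ {i j} → Group._≈_ ℤ₂² (to i) (to j) → i ≡ j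
  injective {zero}           {zero}           _ = refl
  injective {suc zero}       {suc zero}       _ = refl
  injective {suc (suc zero)} {suc (suc zero)} _ = refl
  injective {zero}           {suc zero}       (() , _)
  injective {zero}           {suc (suc zero)} (_ , ())
  injective {suc zero}       {zero}           (() , _)
  injective {suc zero}       {suc (suc zero)} (() , _)
  injective {suc (suc zero)} {zero}           (_ , ())
  injective {suc (suc zero)} {suc zero}       (() , _)

size-lift : ∀ {a ℓ} c ℓ′ {n} (Γ : Group a ℓ) → HasSizeAtLeast n Γ → HasSizeAtLeast n (liftGroup c ℓ′ Γ)
size-lift c ℓ′ Γ inj = record
  { to = lift ∘ to ; cong = lift ∘ cong′ ; injective = injective ∘ lower }
  where open Injection inj renaming (cong to cong′)

-- Integer gains

ℤ/-comm : ∀ n .{{_ : NonZero n}} (i j : Fin n) → Group._∙_ (ℤ/ n) i j ≡ Group._∙_ (ℤ/ n) j i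
ℤ/-comm n i j = cong (_mod n) (ℕ.+-comm (toℕ i) (toℕ j))

ℤ₃×ℤ₂² : AbelianGroup 0ℓ 0ℓ
ℤ₃×ℤ₂² = record { isAbelianGroup = record
  { isGroup = Group.isGroup (ℤ₃ ×ᴳ ℤ₂²)
  ; comm    = λ (i , j , k) (i′ , j′ , k′) → ℤ/-comm 3 i i′ , ℤ/-comm 2 j j′ , ℤ/-comm 2 k k′
  } }

private
  module A = AbelianGroup ℤ₃×ℤ₂²

_≟ᴬ_ : Decidable₂ A._≈_
(i , j , k) ≟ᴬ (i′ , j′ , k′) = (i ≟ i′) ×-dec (j ≟ j′) ×-dec (k ≟ k′)

-- The possible pairs of gains of a cycle that is balanced for both groups or for neither.
Agreeing : Pred A.Carrier 0ℓ
Agreeing (x , y) = (x ≡ Group.ε ℤ₃ → Group._≈_ ℤ₂² y (Group.ε ℤ₂²)) ×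
                   (Group._≈_ ℤ₂² y (Group.ε ℤ₂²) → x ≡ Group.ε ℤ₃)

agreeing? : Decidable Agreeing
agreeing? (x , y , z) =
  ((x ≟ # 0) →-dec ((y ≟ # 0) ×-dec (z ≟ # 0))) ×-dec (((y ≟ # 0) ×-dec (z ≟ # 0)) →-dec (x ≟ # 0))

-- The units of the Eisenstein integers ℤ[ω] are the elements ±1, ±ω, ±ω², and they reduce
-- bijectively onto the pairs of nonzero elements of ℤ[ω]/(√-3) = 𝔽₃ and ℤ[ω]/(2) = 𝔽₄.
-- This is the inverse of that reduction followed by 1, ω, ω² ↦ 1, 1, -2; it is junk off Agreeing.
toInteger : A.Carrier → ℤ
toInteger (zero         , _)               = pos 0
toInteger (suc zero     , zero     , zero) = pos 0
toInteger (suc zero     , suc zero , suc zero) = -[1+ 1 ]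
toInteger (suc zero     , _)               = pos 1
toInteger (suc (suc zero) , zero     , zero) = pos 0
toInteger (suc (suc zero) , suc zero , suc zero) = pos 2
toInteger (suc (suc zero) , _)             = -[1+ 0 ]

all-A? : ∀ {p} {P : Pred A.Carrier p} → Decidable P → Dec (∀ i j k → P (i , j , k))
all-A? P? = Fin.all? λ i → Fin.all? λ j → Fin.all? λ k → P? (i , j , k)

-- As 1 + 1 - 2 = 0 matches 1 + ω + ω² = 0, the values 1, 1, -2 define an additive map on the
-- Eisenstein integers. The lift to them is additive where it has to be, because a sum of two units
-- with agreeing reductions is zero or a unit. The finitely many cases are checked by evaluation.
toInteger-partialHomomorphism :
  IsPartialHomomorphism A.group (AbelianGroup.group ℤ.+-0-abelianGroup) Agreeing toInteger
toInteger-partialHomomorphism = record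
  { S-resp = λ { (refl , refl , refl) → id }
  ; f-cong = λ { (refl , refl , refl) → refl }
  ; f-ε    = refl
  ; f-⁻¹   = λ (i , j , k) → neg i j k
  ; f-∙    = λ { {i , j , k} {i′ , j′ , k′} → add i j k i′ j′ k′ }
  }
  where
  neg : ∀ i j k → toInteger ((i , j , k) A.⁻¹) ≡ ℤ.- toInteger (i , j , k)
  neg = from-yes (all-A? λ x → toInteger (x A.⁻¹) ℤ.≟ (ℤ.- toInteger x))

  add : ∀ i j k i′ j′ k′ → let x = i , j , k ; y = i′ , j′ , k′ in
    Agreeing x → Agreeing y → Agreeing (x A.∙ y) → toInteger (x A.∙ y) ≡ toInteger x ℤ.+ toInteger y
  add = from-yes (all-A? λ x → all-A? λ y →
    agreeing? x →-dec agreeing? y →-dec agreeing? (x A.∙ y) →-dec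
    (toInteger (x A.∙ y) ℤ.≟ toInteger x ℤ.+ toInteger y))

-- No unit is sent to 0, since its image is 1 or -2 up to sign.
toInteger≡0 : ∀ x → Agreeing x → toInteger x ≡ pos 0 → proj₁ x ≡ zero
toInteger≡0 (i , j , k) = from-yes (all-A? λ x →
  agreeing? x →-dec (toInteger x ℤ.≟ pos 0) →-dec (proj₁ x ≟ zero)) i j k

∣toInteger∣≤2 : ∀ x → ∣ toInteger x ∣ ≤ 2
∣toInteger∣≤2 (i , j , k) = from-yes (all-A? λ x → ∣ toInteger x ∣ ℕ.≤? 2) i j k

ℤᴳ : Group 0ℓ 0ℓ
ℤᴳ = AbelianGroup.group ℤ.+-0-abelianGroup

module _ {b} (Ω : BiasedGraph b) where
  open BiasedGraph Ω
  open Gaining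

  -- The bound on cycle gains is what later allows reduction to the powers of any group element that
  -- is not of order 1 or 2.
  gainable-ℤ : Gainable ℤ₃ Ω → Gainable ℤ₂² Ω →
    Σ[ (Λ , _) ∈ Gainable ℤᴳ Ω ] (∀ C → IsCycle C → ∀ {u} (w : Walk graph u u) →
      IsSimpleClosedWalk C w → ∣ gain Λ w ∣ ≤ 2)
  gainable-ℤ (φ , ⊆φ , φ⊆) (ψ , ⊆ψ , ψ⊆) =
    (Λ , balanced , unbalanced) ,
    λ C cyc w simple → subst (λ z → ∣ z ∣ ≤ 2) (sym (proj₂ (cycle-gain C cyc w simple))) (∣toInteger∣≤2 (gains w))
    where
    Φ : Gaining graph A.group
    Φ = pairGaining φ ψ

    η = proj₁ (switch-null-connected Φ)

    Φ′ : Gaining graph A.group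
    Φ′ = switch η Φ

    Λ : Gaining graph ℤᴳ
    Λ = image {A = ℤ₃×ℤ₂²} {K = ℤ.+-0-abelianGroup} _≟ᴬ_ toInteger-partialHomomorphism Φ′

    ℤ₃-abelian ℤ₂²-abelian : AbelianGroup 0ℓ 0ℓ
    ℤ₃-abelian  = record { isAbelianGroup = record { isGroup = Group.isGroup ℤ₃ ; comm = ℤ/-comm 3 } }
    ℤ₂²-abelian = record { isAbelianGroup = record
      { isGroup = Group.isGroup ℤ₂²
      ; comm    = λ (i , j) (i′ , j′) → ℤ/-comm 2 i i′ , ℤ/-comm 2 j j′ } }

    gains : ∀ {u} → Walk graph u u → A.Carrier
    gains w = gain φ w , gain ψ w

    gain-Φ′ : ∀ {u} (w : Walk graph u u) → gain Φ′ w A.≈ gains w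
    gain-Φ′ w = A.trans (gain-switch-closed ℤ₃×ℤ₂² η Φ w) (A.reflexive (gain-pair φ ψ w))

    -- A trivial gain in one group makes the circuit balanced in `Ω`, and hence its gain in the
    -- other group trivial.
    agreeing : ∀ {e u v} .(a : Graph.IsArc graph e u v) (p : Walk graph v u) → IsCircuit e p →
      Agreeing (gains (step e a p))
    agreeing {e} a p circuit =
      (λ null → proj₂ (⊆ψ (φ⊆ {C} (circuit-balanced ℤ₃-abelian φ a p circuit null))) _ simple) ,
      (λ null → proj₂ (⊆φ (ψ⊆ {C} (circuit-balanced ℤ₂²-abelian ψ a p circuit null))) _ simple)
      where
      C      = walkSubgraph (step e a p)
      simple = circuit-simple a p circuit

    agreeing′ : ∀ {e u v} .(a : Graph.IsArc graph e u v) (p : Walk graph v u) → IsCircuit e p →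
      Agreeing (gain Φ′ (step e a p))
    agreeing′ a p circuit = IsPartialHomomorphism.S-resp toInteger-partialHomomorphism
      (A.sym (gain-Φ′ (step _ a p))) (agreeing a p circuit)

    cycle-gain : ∀ C → IsCycle C → ∀ {u} (w : Walk graph u u) → IsSimpleClosedWalk C w →
      Agreeing (gains w) × gain Λ w ≡ toInteger (gains w)
    cycle-gain C cyc {u} nil         simple = contradiction simple (cycle-walk-nonempty C cyc {u})
    cycle-gain C cyc (step e a p) simple =
      agreeing a p circuit ,
      trans (image-gain {A = ℤ₃×ℤ₂²} {K = ℤ.+-0-abelianGroup} _≟ᴬ_ toInteger-partialHomomorphism
               Φ′ (proj₂ (switch-null-connected Φ)) agreeing′ a p circuit)
            (IsPartialHomomorphism.f-cong toInteger-partialHomomorphism (gain-Φ′ (step e a p)))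
      where circuit = cycle-circuit C cyc a p simple

    balanced : ∀ {C} → Balanced C → 𝓑 Λ C
    balanced {C} C∈ = cycles C∈ , λ w simple →
      trans (proj₂ (cycle-gain C (cycles C∈) w simple))
        (IsPartialHomomorphism.f-cong toInteger-partialHomomorphism
          {y = A.ε} (proj₂ (⊆φ C∈) w simple , proj₂ (⊆ψ C∈) w simple))

    unbalanced : ∀ {C} → 𝓑 Λ C → Balanced C
    unbalanced {C} (cyc , null) = φ⊆ {C} (cyc , λ w simple →
      let agree , eq = cycle-gain C cyc w simple
      in toInteger≡0 _ agree (trans (sym eq) (null w simple)))

-- Groups with at least three elements

module _ {c ℓ} (Γ : Group c ℓ) where
  open Group Γ hiding (refl; sym; trans)
  private module Γ = Group Γ
  open GroupProperties Γ
  open Mult monoid renaming (_×_ to _·_)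
  open SetoidReasoning setoid

  -- Integer powers of an element

  pow : Carrier → ℤ → Carrier
  pow g (pos n)    = n · g
  pow g -[1+ n ] = (suc n · g) ⁻¹

  -- Integer addition with mixed signs computes to `⊖`. Both arguments are lowered together while
  -- one factor `g` cancels.
  pow-⊖ : ∀ g m n → pow g (m ⊖ n) ≈ m · g ∙ (n · g) ⁻¹
  pow-⊖ g m       zero    = begin
    m · g          ≈⟨ identityʳ _ ⟨
    m · g ∙ ε      ≈⟨ ∙-congˡ ε⁻¹≈ε ⟨
    m · g ∙ ε ⁻¹   ∎
  pow-⊖ g zero    (suc n) = Γ.sym (identityˡ _)
  pow-⊖ g (suc m) (suc n) = begin
    pow g (suc m ⊖ suc n)               ≡⟨ cong (pow g) (ℤ.[1+m]⊖[1+n]≡m⊖n m n) ⟩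
    pow g (m ⊖ n)                       ≈⟨ pow-⊖ g m n ⟩
    m · g ∙ (n · g) ⁻¹                  ≈⟨ ∙-congʳ (//-rightDividesʳ g (m · g)) ⟨
    m · g ∙ g ∙ g ⁻¹ ∙ (n · g) ⁻¹       ≈⟨ assoc _ _ _ ⟩
    m · g ∙ g ∙ (g ⁻¹ ∙ (n · g) ⁻¹)     ≈⟨ ∙-congˡ (⁻¹-anti-homo-∙ _ _) ⟨
    m · g ∙ g ∙ (n · g ∙ g) ⁻¹          ≈⟨ ∙-cong (snoc m) (⁻¹-cong (snoc n)) ⟩
    suc m · g ∙ (suc n · g) ⁻¹          ∎
    where
    snoc : ∀ n → n · g ∙ g ≈ suc n · g
    snoc n = begin
      n · g ∙ g         ≈⟨ ∙-congˡ (identityʳ g) ⟨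
      n · g ∙ 1 · g     ≈⟨ ×-homo-+ g n 1 ⟨
      (n + 1) · g       ≡⟨ cong (_· g) (ℕ.+-comm n 1) ⟩
      suc n · g         ∎

  ·-commute : ∀ g m n → m · g ∙ n · g ≈ n · g ∙ m · g
  ·-commute g m n = begin
    m · g ∙ n · g  ≈⟨ ×-homo-+ g m n ⟨
    (m + n) · g    ≡⟨ cong (_· g) (ℕ.+-comm m n) ⟩
    (n + m) · g    ≈⟨ ×-homo-+ g n m ⟩
    n · g ∙ m · g  ∎

  pow-∙ : ∀ g i j → pow g (i ℤ.+ j) ≈ pow g i ∙ pow g j
  pow-∙ g (pos m)    (pos n)    = ×-homo-+ g m n
  pow-∙ g (pos m)    -[1+ n ] = pow-⊖ g m (suc n)
  pow-∙ g -[1+ m ] (pos n)    = begin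
    pow g (n ⊖ suc m)               ≈⟨ pow-⊖ g n (suc m) ⟩
    N ∙ M ⁻¹                        ≈⟨ \\-leftDividesʳ M _ ⟨
    M ⁻¹ ∙ (M ∙ (N ∙ M ⁻¹))         ≈⟨ ∙-congˡ (assoc M N _) ⟨
    M ⁻¹ ∙ (M ∙ N ∙ M ⁻¹)           ≈⟨ ∙-congˡ (∙-congʳ (·-commute g (suc m) n)) ⟩
    M ⁻¹ ∙ (N ∙ M ∙ M ⁻¹)           ≈⟨ ∙-congˡ (//-rightDividesʳ M N) ⟩
    M ⁻¹ ∙ N                        ∎
    where
    M = suc m · g
    N = n · g
  pow-∙ g -[1+ m ] -[1+ n ] = begin
    (suc (suc (m + n)) · g) ⁻¹           ≡⟨ cong (λ k → (suc k · g) ⁻¹) (trans (cong suc (ℕ.+-comm m n)) (sym (ℕ.+-suc n m))) ⟩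
    ((suc n + suc m) · g) ⁻¹             ≈⟨ ⁻¹-cong (×-homo-+ g (suc n) (suc m)) ⟩
    (suc n · g ∙ suc m · g) ⁻¹           ≈⟨ ⁻¹-anti-homo-∙ _ _ ⟩
    (suc m · g) ⁻¹ ∙ (suc n · g) ⁻¹      ∎

  -- Nonzero integers in this range are ±1 and ±2, and neither `g` nor `g ∙ g` nor their inverses
  -- are trivial.
  pow-kernel : ∀ {g} → ¬ g ≈ ε → ¬ g ∙ g ≈ ε → ∀ z → ∣ z ∣ ≤ 2 → pow g z ≈ ε → z ≡ pos 0
  pow-kernel {g} g≉ε g²≉ε = kernel
    where
    nonzero : ∀ n → n < 2 → ¬ suc n · g ≈ ε
    nonzero zero          _ eq = g≉ε (Γ.trans (Γ.sym (identityʳ g)) eq)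
    nonzero (suc zero)    _ eq = g²≉ε (Γ.trans (Γ.sym (∙-congˡ (identityʳ g))) eq)
    nonzero (suc (suc _)) (s≤s (s≤s ()))

    kernel : ∀ z → ∣ z ∣ ≤ 2 → pow g z ≈ ε → z ≡ pos 0
    kernel (pos zero)  _     _  = refl
    kernel (pos (suc n)) bound eq = contradiction eq (nonzero n bound)
    kernel -[1+ n ]  bound eq =
      contradiction (⁻¹-injective (Γ.trans eq (Γ.sym ε⁻¹≈ε))) (nonzero n bound)

  gainable-by-powers : ∀ {b} (Ω : BiasedGraph b) → Gainable ℤ₃ Ω → Gainable ℤ₂² Ω →
    ∀ {g} → ¬ g ≈ ε → ¬ g ∙ g ≈ ε → Gainable Γ Ω
  gainable-by-powers Ω g₃ g₂₂ {g} g≉ε g²≉ε with gainable-ℤ Ω g₃ g₂₂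
  ... | gℤ , bounded = gainable-map Ω (pow g) (λ { refl → Γ.refl }) (pow-∙ g) gℤ
    λ C cyc w simple → pow-kernel g≉ε g²≉ε _ (bounded C cyc w simple)

  -- Klein four-groups generated by two elements

  module _ {a b : Carrier} (a²≈ε : a ∙ a ≈ ε) (b²≈ε : b ∙ b ≈ ε) ([ab]²≈ε : a ∙ b ∙ (a ∙ b) ≈ ε) where

    private
      pow₂ : Carrier → Fin 2 → Carrier
      pow₂ g zero       = ε
      pow₂ g (suc zero) = g

      pow₂-∙ : ∀ {g} → g ∙ g ≈ ε → ∀ i j → pow₂ g (Group._∙_ (ℤ/ 2) i j) ≈ pow₂ g i ∙ pow₂ g j
      pow₂-∙ _  zero       zero       = Γ.sym (identityˡ _)
      pow₂-∙ _  zero       (suc zero) = Γ.sym (identityˡ _)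
      pow₂-∙ _  (suc zero) zero       = Γ.sym (identityʳ _)
      pow₂-∙ g² (suc zero) (suc zero) = Γ.sym g²

      -- Each of `a`, `b` and `a ∙ b` is its own inverse, and inversion reverses products.
      ba≈ab : b ∙ a ≈ a ∙ b
      ba≈ab = begin
        b ∙ a           ≈⟨ ∙-cong (inverseˡ-unique b b b²≈ε) (inverseˡ-unique a a a²≈ε) ⟩
        b ⁻¹ ∙ a ⁻¹     ≈⟨ ⁻¹-anti-homo-∙ a b ⟨
        (a ∙ b) ⁻¹      ≈⟨ inverseˡ-unique (a ∙ b) (a ∙ b) [ab]²≈ε ⟨
        a ∙ b           ∎

      pow₂-commute : ∀ i j → pow₂ b j ∙ pow₂ a i ≈ pow₂ a i ∙ pow₂ b j
      pow₂-commute zero       _          = Γ.trans (identityʳ _) (Γ.sym (identityˡ _))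
      pow₂-commute (suc zero) zero       = Γ.trans (identityˡ _) (Γ.sym (identityʳ _))
      pow₂-commute (suc zero) (suc zero) = ba≈ab

    klein : Group.Carrier ℤ₂² → Carrier
    klein (i , j) = pow₂ a i ∙ pow₂ b j

    klein-∙ : ∀ x y → klein (Group._∙_ ℤ₂² x y) ≈ klein x ∙ klein y
    klein-∙ (i , j) (i′ , j′) = begin
      _                                                ≈⟨ ∙-cong (pow₂-∙ a²≈ε i i′) (pow₂-∙ b²≈ε j j′) ⟩
      (pow₂ a i ∙ pow₂ a i′) ∙ (pow₂ b j ∙ pow₂ b j′)  ≈⟨ assoc _ _ _ ⟩
      pow₂ a i ∙ (pow₂ a i′ ∙ (pow₂ b j ∙ pow₂ b j′))  ≈⟨ ∙-congˡ (assoc _ _ _) ⟨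
      pow₂ a i ∙ (pow₂ a i′ ∙ pow₂ b j ∙ pow₂ b j′)    ≈⟨ ∙-congˡ (∙-congʳ (pow₂-commute i′ j)) ⟨
      pow₂ a i ∙ (pow₂ b j ∙ pow₂ a i′ ∙ pow₂ b j′)    ≈⟨ ∙-congˡ (assoc _ _ _) ⟩
      pow₂ a i ∙ (pow₂ b j ∙ (pow₂ a i′ ∙ pow₂ b j′))  ≈⟨ assoc _ _ _ ⟨
      (pow₂ a i ∙ pow₂ b j) ∙ (pow₂ a i′ ∙ pow₂ b j′)  ∎

    -- A trivial product `a ∙ b` would make `a` the inverse of `b`, which is `b` itself.
    klein-kernel : ¬ a ≈ ε → ¬ b ≈ ε → ¬ a ≈ b → ∀ x → klein x ≈ ε → Group._≈_ ℤ₂² x (Group.ε ℤ₂²)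
    klein-kernel a≉ε b≉ε a≉b (zero     , zero)     _  = refl , refl
    klein-kernel a≉ε b≉ε a≉b (zero     , suc zero) eq =
      contradiction (Γ.trans (Γ.sym (identityˡ b)) eq) b≉ε
    klein-kernel a≉ε b≉ε a≉b (suc zero , zero)     eq =
      contradiction (Γ.trans (Γ.sym (identityʳ a)) eq) a≉ε
    klein-kernel a≉ε b≉ε a≉b (suc zero , suc zero) eq =
      contradiction (Γ.trans (inverseˡ-unique a b eq) (Γ.sym (inverseˡ-unique b b b²≈ε))) a≉b

  -- Choice between powers and a Klein four-group

  module _ (em : ExcludedMiddle ℓ) where

    -- At most one of three distinct elements is `ε`; excluded middle decides which, as equality in
    -- `Γ` may be undecidable.
    two-nontrivial : HasSizeAtLeast 3 Γ → ∃[ a ] ∃[ b ] ¬ a ≈ ε × ¬ b ≈ ε × ¬ a ≈ b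
    two-nontrivial inj = pick em em
      where
      open Injection inj using (to; injective)
      distinct : ∀ {i j} → i ≢ j → ¬ to i ≈ to j
      distinct i≢j eq = i≢j (injective eq)

      avoid : ∀ {i j} → to i ≈ ε → i ≢ j → ¬ to j ≈ ε
      avoid p i≢j q = distinct i≢j (Γ.trans p (Γ.sym q))

      pick : Dec (to (# 0) ≈ ε) → Dec (to (# 1) ≈ ε) → _
      pick (yes p) _       = to (# 1) , to (# 2) , avoid p (λ ()) , avoid p (λ ()) , distinct λ ()
      pick (no p)  (yes q) = to (# 0) , to (# 2) , p , avoid q (λ ()) , distinct λ ()
      pick (no p)  (no q)  = to (# 0) , to (# 1) , p , q , distinct λ ()

    -- If one of `a`, `b`, `a ∙ b` has a nontrivial square, its powers serve. Otherwise `a` and `b`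
    -- generate a Klein four-group, into which the ℤ₂²-gaining is carried.
    gainable-of-ℤ₃-ℤ₂² : ∀ {b} (Ω : BiasedGraph b) → Gainable ℤ₃ Ω → Gainable ℤ₂² Ω →
      HasSizeAtLeast 3 Γ → Gainable Γ Ω
    gainable-of-ℤ₃-ℤ₂² Ω g₃ g₂₂ size with two-nontrivial size
    ... | a , b , a≉ε , b≉ε , a≉b
      with em {P = a ∙ a ≈ ε} | em {P = b ∙ b ≈ ε} | em {P = a ∙ b ∙ (a ∙ b) ≈ ε}
    ... | no a²≉ε | _ | _ = gainable-by-powers Ω g₃ g₂₂ a≉ε a²≉ε
    ... | yes _ | no b²≉ε | _ = gainable-by-powers Ω g₃ g₂₂ b≉ε b²≉ε
    ... | yes _ | yes b² | no [ab]²≉ε = gainable-by-powers Ω g₃ g₂₂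
      -- The product is nontrivial: otherwise `a` would be the inverse of `b`, and `b` is its own
      -- inverse.
      (λ eq → a≉b (Γ.trans (inverseˡ-unique a b eq) (Γ.sym (inverseˡ-unique b b b²)))) [ab]²≉ε
    ... | yes a² | yes b² | yes [ab]² = gainable-map Ω (klein a² b² [ab]²)
      (λ { (refl , refl) → Γ.refl }) (klein-∙ a² b² [ab]²) g₂₂
      λ _ _ w _ → klein-kernel a² b² [ab]² a≉ε b≉ε a≉b _

theorem1p6 : ∀ {c ℓ b} → ExcludedMiddle ℓ → (Ω : BiasedGraph b) →
    ((Γ : Group c ℓ) → HasSizeAtLeast 3 Γ → Gainable Γ Ω) ⇔ (Gainable ℤ₃ Ω × Gainable ℤ₂² Ω)
theorem1p6 {c} {ℓ} em Ω = mk⇔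
  (λ gainable →
    gainable-lower ℤ₃ Ω (gainable (liftGroup c ℓ ℤ₃) (size-lift c ℓ ℤ₃ ℤ₃-size)) ,
    gainable-lower ℤ₂² Ω (gainable (liftGroup c ℓ ℤ₂²) (size-lift c ℓ ℤ₂² ℤ₂²-size)))
  (λ (g₃ , g₂₂) Γ size → gainable-of-ℤ₃-ℤ₂² Γ em Ω g₃ g₂₂ size)
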